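{- Let $\mathcal I$ be a Borel ideal on $\omega$. The following conditions are equivalent: (1) the notions of P-point and $\mathcal I$-ultrafilter coincide; (2) $\mathcal I\le_K\mathrm{Fin}^2$ and $\mathcal I$ is not extendable to an $F_\sigma$ ideal (i.e. there is no $F_\sigma$ ideal $\mathcal I'$ on $\omega$ with $\mathcal I\subseteq\mathcal I'$).
   Context: An ideal on a set $X$ is a family of subsets of $X$ closed under finite unions and subsets, containing all finite subsets of $X$ and not containing $X$. Borel and $F_\sigma$ refer to the topology of $\mathcal P(\omega)\cong\{0,1\}^\omega$. $\mathrm{Fin}^2=\{A\subseteq\omega\times\omega:$ for all but finitely many $n$ the section $\{k:(n,k)\in A\}$ is finite$\}$. For ideals $\mathcal I$ on $X$ and $\mathcal K$ on $Y$, $\mathcal I\le_K\mathcal K$ (Katětov order) means that there is $f:Y\to X$ with $f^{ -1}[B]\in\mathcal K$ for all $B\in\mathcal I$. Ultrafilters on $\omega$ contain all cofinite sets; $\mathcal U^*=\{\omega\setminus A:A\in\mathcal U\}$. An ultrafilter $\mathcal U$ on $\omega$ is an $\mathcal I$-ultrafilter if $\mathcal I\not\le_K\mathcal U^*$. An ultrafilter $\mathcal U$ on $\omega$ is a P-point if for every countable $\mathcal A\subseteq\mathcal U^*$ there is $B\in\mathcal U$ with $A\cap B$ finite for all $A\in\mathcal A$.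
   Formalization: The implication from (1) to (2) is proved assuming the continuum hypothesis; without such an assumption it can fail: in a model with no P-points, I = Fin satisfies (1) vacuously but is itself an F_σ ideal. The implication from (2) to (1) needs no such assumption. -}

module Defs where

open import Data.Bool using (Bool; true; false; _∧_; _∨_; not; T)
open import Data.List using (List)
import Data.List.Membership.Propositional as List
open import Data.Nat using (ℕ; _<_)
open import Data.Product using (∃; _×_; _,_)
open import Data.Sum using (_⊎_)
open import Function using (_∘_; const)
open import Induction.WellFounded using (WellFounded)
open import Level using (0ℓ)
open import Relation.Binary using (Rel; IsStrictTotalOrder)
open import Relation.Binary.PropositionalEquality using (_≡_; _≗_)
open import Relation.Nullary using (¬_)
open import Relation.Unary using (Pred; _⊆_; _≐_; ∁; ⋃)

-- The power set of X is {0,1}^X, with pointwise equality _≗_ as equality of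
-- sets.  Under excluded middle every predicate on X has a characteristic
-- function, so no subsets are lost.
Subset : Set → Set
Subset X = X → Bool

-- Excluded middle at level ℓ makes every predicate of level ℓ equivalent to one
-- of level 0, so restricting to level 0 loses nothing.
Family : Set → Set₁
Family X = Pred (Subset X) 0ℓ

module _ {X : Set} where

  infix 4 _⊆ˢ_
  infixr 7 _∩ˢ_
  infixr 6 _∪ˢ_

  ∅ˢ fullˢ : Subset X
  ∅ˢ    = const false
  fullˢ = const true

  _∪ˢ_ _∩ˢ_ : Subset X → Subset X → Subset X
  (A ∪ˢ B) x = A x ∨ B x
  (A ∩ˢ B) x = A x ∧ B x

  ∁ˢ : Subset X → Subset X
  ∁ˢ A = not ∘ A

  _⊆ˢ_ : Subset X → Subset X → Set
  A ⊆ˢ B = (T ∘ A) ⊆ (T ∘ B)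

  Finite : Subset X → Set
  Finite A = ∃ λ (xs : List X) → ∀ x → T (A x) → x List.∈ xs

  -- The sequence may leave 𝒮, so finite families, including the empty one,
  -- are countable.
  Countable : Family X → Set
  Countable 𝒮 = ∃ λ (e : ℕ → Subset X) → ∀ A → 𝒮 A → ∃ λ n → e n ≗ A

-- The empty union needs no clause: ∅ is finite.
record IsIdeal {X : Set} (ℐ : Family X) : Set where
  field
    ∪-closed : ∀ A B → ℐ A → ℐ B → ℐ (A ∪ˢ B)
    ⊆-closed : ∀ A B → A ⊆ˢ B → ℐ B → ℐ A
    finite   : ∀ A → Finite A → ℐ A
    proper   : ¬ ℐ fullˢ

-- The basic neighbourhoods of A in the product topology of {0,1}^ℕ are the sets
-- of all B agreeing with A on an initial segment of ℕ.
IsOpen : Family ℕ → Set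
IsOpen 𝒪 = ∀ A → 𝒪 A → ∃ λ n → ∀ B → (∀ i → i < n → A i ≡ B i) → 𝒪 B

IsClosed : Family ℕ → Set
IsClosed 𝒞 = IsOpen (∁ 𝒞)

IsFσ : Family ℕ → Set₁
IsFσ 𝒮 = ∃ λ (𝒞 : ℕ → Family ℕ) → (∀ n → IsClosed (𝒞 n)) × 𝒮 ≐ ⋃ ℕ 𝒞

-- The σ-algebra generated by the open sets; ≐-resp is extensionality, needed
-- because families are predicates.
data Borel : Family ℕ → Set₁ where
  open-set   : ∀ {𝒪} → IsOpen 𝒪 → Borel 𝒪
  complement : ∀ {𝒮} → Borel 𝒮 → Borel (∁ 𝒮)
  union      : ∀ {𝒮 : ℕ → Family ℕ} → (∀ n → Borel (𝒮 n)) → Borel (⋃ ℕ 𝒮)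
  ≐-resp     : ∀ {𝒮 𝒯} → 𝒮 ≐ 𝒯 → Borel 𝒮 → Borel 𝒯

-- ns lists the finitely many exceptional columns.
Fin² : Family (ℕ × ℕ)
Fin² A = ∃ λ (ns : List ℕ) → ∀ n → ¬ (n List.∈ ns) → Finite (λ k → A (n , k))

infix 4 _≤K_
_≤K_ : {X Y : Set} → Family X → Family Y → Set
_≤K_ {X} {Y} ℐ 𝒦 = ∃ λ (f : Y → X) → ∀ B → ℐ B → 𝒦 (B ∘ f)

record IsUltrafilter (𝒰 : Family ℕ) : Set where
  field
    ∩-closed : ∀ A B → 𝒰 A → 𝒰 B → 𝒰 (A ∩ˢ B)
    ⊇-closed : ∀ A B → A ⊆ˢ B → 𝒰 A → 𝒰 B
    cofinite : ∀ A → Finite (∁ˢ A) → 𝒰 A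
    proper   : ¬ 𝒰 ∅ˢ
    ultra    : ∀ A → 𝒰 A ⊎ 𝒰 (∁ˢ A)

infix 9 _*
_* : Family ℕ → Family ℕ
(𝒰 *) A = ∃ λ B → 𝒰 B × A ≗ ∁ˢ B

IsUltrafilterFor : Family ℕ → Family ℕ → Set
IsUltrafilterFor ℐ 𝒰 = ¬ (ℐ ≤K 𝒰 *)

IsPPoint : Family ℕ → Set₁
IsPPoint 𝒰 = ∀ (𝒜 : Family ℕ) → Countable 𝒜 → 𝒜 ⊆ 𝒰 * →
  ∃ λ B → 𝒰 B × (∀ A → 𝒜 A → Finite (A ∩ˢ B))

ExtendsToFσIdeal : Family ℕ → Set₁
ExtendsToFσIdeal ℐ = ∃ λ (ℐ′ : Family ℕ) → IsIdeal ℐ′ × IsFσ ℐ′ × ℐ ⊆ ℐ′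

-- CH in the form 2^ℵ₀ ≤ ℵ₁: some well-order of {0,1}^ℕ has only countable
-- proper initial segments.
ContinuumHypothesis : Set₁
ContinuumHypothesis = ∃ λ (_≺_ : Rel (Subset ℕ) 0ℓ) →
  IsStrictTotalOrder _≗_ _≺_ × WellFounded _≺_ × (∀ A → Countable (_≺ A))

PPointsCoincideWith : Family ℕ → Set₁
PPointsCoincideWith ℐ = ∀ (𝒰 : Family ℕ) → IsUltrafilter 𝒰 →
  (IsPPoint 𝒰 → IsUltrafilterFor ℐ 𝒰) × (IsUltrafilterFor ℐ 𝒰 → IsPPoint 𝒰)

module Submission where

-- Excluded middle is used in the form that decides each type and, when the type
-- is inhabited, hands over an element.  Since the existential quantifier is a
-- strong sum, all the choices made below are thereby justified.
--
-- Suppose first that ℐ is Katětov below Fin² and is not extendable to an Fσ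
-- ideal.  That an ultrafilter is not a P-point is witnessed by a sequence of dual
-- sets; sending x to (first set containing x, x) shows that Fin² is Katětov below
-- its dual ideal, hence so is ℐ (≰Fin²⇒p-point).
-- Conversely, if 𝒰 is a P-point and f witnesses ℐ ≤K 𝒰 *, then the image 𝒱 of
-- 𝒰 under f is an ultrafilter disjoint from ℐ in which every sequence has a
-- pseudo-intersection, and it suffices to extend ℐ to an Fσ ideal
-- (extends-to-Fσ).  The ideal ℐ is the projection of a closed set of pairs
-- (A , w), because it is Borel.  If no Fσ family separates ℐ from 𝒱, then
-- removing the basic neighbourhoods over which they can be separated leaves a
-- nonempty closed kernel, and each neighbourhood meeting the kernel has a member
-- of 𝒱 in the closure of its part of ℐ.  Take B in 𝒱 almost contained in all
-- these countably many members.  Two branches through the kernel, built in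
-- alternation, copy such members on alternate intervals and thus yield c and c′
-- in ℐ whose union almost contains B (covered-or-separated): so B lies in ℐ, a
-- contradiction.  Hence some Fσ family contains ℐ and lies in the ideal 𝒱 *, and
-- by compactness it generates an Fσ ideal (Fσ-generates).
--
-- Now suppose CH and that the two notions coincide.  Both conclusions come from
-- counterexamples to coincidence.  Each is an ultrafilter disjoint from an ideal
-- 𝒥, constructed by meeting, one after another along a well-order of the
-- continuum, requirements that can be met below any decreasing sequence of sets
-- outside 𝒥 (meeting-ultrafilter).  If ℐ is contained in an Fσ ideal 𝒥, then decreasing
-- sequences outside 𝒥 have pseudo-intersections outside 𝒥, and one obtains a
-- P-point disjoint from ℐ, which is not an ℐ-ultrafilter.  If ℐ is not Katětov
-- below Fin², take for 𝒥 a copy of Fin² on ℕ and require for each f a preimage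
-- under f of a member of ℐ: the result is an ℐ-ultrafilter, and the columns show
-- that it is not a P-point.

open import Axiom.ExcludedMiddle using (ExcludedMiddle)
open import Data.Bool using (Bool; true; false; not; _∧_; T)
open import Data.Bool.Properties using (T-∧; T-∨; not-involutive)
open import Data.Empty using (⊥; ⊥-elim)
open import Data.List using (List; []; _∷_; _++_; map; upTo)
open import Data.List.Membership.Propositional.Properties using (∈-map⁺; ∈-upTo⁺; ∈-++⁺ˡ; ∈-++⁺ʳ)
open import Data.List.Relation.Unary.All using (All; []; _∷_) renaming (map to All-map)
open import Data.List.Relation.Unary.All.Properties using (++⁺)
open import Data.List.Relation.Unary.Any using (here; there)
import Data.List.Membership.Propositional as List
open import Data.Nat using (ℕ; zero; suc; _+_; _⊔_; _≤_; _<_; z≤n; s≤s; _<?_)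
open import Data.Nat.Induction using (<-wellFounded)
open import Data.Nat.Properties
open import Data.Product using (∃; ∃₂; Σ; _×_; _,_; proj₁; proj₂; uncurry)
open import Data.Sum using (_⊎_; inj₁; inj₂) renaming (map to ⊎-map)
open import Data.Unit using (⊤; tt)
open import Function using (_∘_; id; const; case_of_; _⇔_; mk⇔)
open import Function.Bundles using (Equivalence)
open import Induction.WellFounded using (Acc; acc)
open import Level using (0ℓ; Lift; lift; lower) renaming (suc to lsuc)
open import Relation.Binary using (Rel; IsStrictTotalOrder; tri<; tri≈; tri>)
open import Relation.Binary.PropositionalEquality using (_≡_; _≗_; refl; sym; trans; cong; cong₂; subst)
open import Relation.Nullary using (¬_; yes; no; contradiction)
open import Relation.Nullary.Decidable using (True; isYes; toWitness; fromWitness; map′; decidable-stable)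
open import Relation.Unary using (Pred; _⊆_; _≐_; ∁; ⋃; _∪_)
open import Defs

open Equivalence using (to; from)

private variable
  Ω : Set

-- Subsets as characteristic functions

∩-intro : (A B : Subset Ω) → ∀ {x} → T (A x) → T (B x) → T ((A ∩ˢ B) x)
∩-intro A B {x} a b = from (T-∧ {A x} {B x}) (a , b)

∩-elim : (A B : Subset Ω) → ∀ {x} → T ((A ∩ˢ B) x) → T (A x) × T (B x)
∩-elim A B {x} = to (T-∧ {A x} {B x})

∪-intro : (A B : Subset Ω) → ∀ {x} → T (A x) ⊎ T (B x) → T ((A ∪ˢ B) x)
∪-intro A B {x} = from (T-∨ {A x} {B x})

∪-elim : (A B : Subset Ω) → ∀ {x} → T ((A ∪ˢ B) x) → T (A x) ⊎ T (B x)
∪-elim A B {x} = to (T-∨ {A x} {B x})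

⊆-∪ : (A B : Subset Ω) → A ⊆ˢ (A ∪ˢ B)
⊆-∪ A B a = ∪-intro A B (inj₁ a)

T-dichotomy : ∀ b → T b ⊎ T (not b)
T-dichotomy true  = inj₁ tt
T-dichotomy false = inj₂ tt

T-contradiction : ∀ b → T b → T (not b) → ⊥
T-contradiction true _ ()

T-absurd⇒not : ∀ b → ¬ T b → T (not b)
T-absurd⇒not true  ¬b = ¬b tt
T-absurd⇒not false _  = tt

T-resp : ∀ {b c} → b ≡ c → T b → T c
T-resp refl t = t

≗⇒⊆ : {A B : Subset Ω} → A ≗ B → A ⊆ˢ B
≗⇒⊆ A≗B {x} = T-resp (A≗B x)

⋂ˢ : List (Subset Ω) → Subset Ω
⋂ˢ []       = fullˢ
⋂ˢ (A ∷ As) = A ∩ˢ ⋂ˢ As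

⋂-++ : (As Bs : List (Subset Ω)) → ⋂ˢ (As ++ Bs) ⊆ˢ (⋂ˢ As ∩ˢ ⋂ˢ Bs)
⋂-++ []       Bs t = ∩-intro fullˢ (⋂ˢ Bs) tt t
⋂-++ (A ∷ As) Bs t with ∩-elim A (⋂ˢ (As ++ Bs)) t
... | a , rest with ∩-elim (⋂ˢ As) (⋂ˢ Bs) (⋂-++ As Bs rest)
...   | as , bs = ∩-intro (⋂ˢ (A ∷ As)) (⋂ˢ Bs) (∩-intro A (⋂ˢ As) a as) bs

-- Finite sets of natural numbers and inclusion modulo finite sets

Bounded : Subset ℕ → Set
Bounded A = ∃ λ N → ∀ x → T (A x) → x < N

infix 4 _⊆*_
_⊆*_ : Subset ℕ → Subset ℕ → Set
A ⊆* B = ∃ λ N → ∀ x → N ≤ x → T (A x) → T (B x)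

list-bound : (xs : List ℕ) → ∃ λ N → ∀ x → x List.∈ xs → x < N
list-bound []       = 0 , λ _ ()
list-bound (y ∷ ys) with list-bound ys
... | N , below = suc y ⊔ N , λ where
  x (here refl) → m≤m⊔n (suc y) N
  x (there x∈)  → ≤-trans (below x x∈) (m≤n⊔m (suc y) N)

finite⇒bounded : (A : Subset ℕ) → Finite A → Bounded A
finite⇒bounded A (xs , A⊆xs) with list-bound xs
... | N , below = N , λ x x∈A → below x (A⊆xs x x∈A)

bounded⇒finite : (A : Subset ℕ) → Bounded A → Finite A
bounded⇒finite A (N , below) = upTo N , λ x x∈A → ∈-upTo⁺ (below x x∈A)

finite-⊆ : {A B : Subset Ω} → A ⊆ˢ B → Finite B → Finite A
finite-⊆ A⊆B (xs , B⊆xs) = xs , λ x x∈A → B⊆xs x (A⊆B x∈A)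

-- A function with k ≤ h k is finite-to-one.
finite-preimage : (h : ℕ → ℕ) → (∀ k → k ≤ h k) → (A : Subset ℕ) → Finite A → Finite (A ∘ h)
finite-preimage h k≤hk A fin with finite⇒bounded A fin
... | N , below = bounded⇒finite (A ∘ h) (N , λ k hk∈A → ≤-<-trans (k≤hk k) (below (h k) hk∈A))

bound-below : (f : ℕ → ℕ) → ∀ n → ∃ λ N → ∀ k → k < n → f k < N
bound-below f zero    = 0 , λ _ ()
bound-below f (suc n) with bound-below f n
... | N , below = N ⊔ suc (f n) , λ k k<1+n → case m<1+n⇒m<n∨m≡n k<1+n of λ where
  (inj₁ k<n)  → ≤-trans (below k k<n) (m≤m⊔n N (suc (f n)))
  (inj₂ refl) → m≤n⊔m N (suc (f n))

abstract
  below : ℕ → Subset ℕ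
  below n x = isYes (x <? n)

  below-intro : ∀ {n x} → x < n → T (below n x)
  below-intro = fromWitness

  below-elim : ∀ {n x} → T (below n x) → x < n
  below-elim = toWitness

below-finite : ∀ n → Finite (below n)
below-finite n = bounded⇒finite (below n) (n , λ _ → below-elim)

⊆*⇒⊆-∪ : ∀ {A B} (A⊆*B : A ⊆* B) → A ⊆ˢ (below (proj₁ A⊆*B) ∪ˢ B)
⊆*⇒⊆-∪ {B = B} (N , A⊆B) {x} x∈A with x <? N
... | yes x<N = ∪-intro (below N) B (inj₁ (below-intro x<N))
... | no  x≮N = ∪-intro (below N) B (inj₂ (A⊆B x (≮⇒≥ x≮N) x∈A))

decreasing⇒antitone : (D : ℕ → Subset Ω) → (∀ n → D (suc n) ⊆ˢ D n) → ∀ {m n} → m ≤ n → D n ⊆ˢ D m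
decreasing⇒antitone D decreasing {m} {zero}  z≤n   p = p
decreasing⇒antitone D decreasing {m} {suc n} m≤1+n p = case m≤n⇒m<n∨m≡n m≤1+n of λ where
  (inj₁ m<1+n) → decreasing⇒antitone D decreasing (m<1+n⇒m≤n m<1+n) (decreasing n p)
  (inj₂ refl)  → p

-- Coding pairs and finite sequences by natural numbers

-- Cantor's walk along the antidiagonals.
unpair : ℕ → ℕ × ℕ
unpair zero    = 0 , 0
unpair (suc m) = next (unpair m)
  where
  next : ℕ × ℕ → ℕ × ℕ
  next (zero  , k) = suc k , 0
  next (suc n , k) = n , suc k

-- The walk visits (n , suc k) right after (suc n , k), and (suc n , 0) right
-- after (0 , n): induction on the diagonal s, then on k.
unpair-reaches : ∀ s n k → n + k ≡ s → ∃ λ m → unpair m ≡ (n , k)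
unpair-reaches s n (suc k) eq with unpair-reaches s (suc n) k (trans (sym (+-suc n k)) eq)
... | m , eq′ = suc m , step eq′
  where
  step : unpair m ≡ (suc n , k) → unpair (suc m) ≡ (n , suc k)
  step p rewrite p = refl
unpair-reaches s       zero    zero eq = 0 , refl
unpair-reaches (suc s) (suc n) zero eq with unpair-reaches s 0 n (trans (sym (+-identityʳ n)) (suc-injective eq))
... | m , eq′ = suc m , step eq′
  where
  step : unpair m ≡ (0 , n) → unpair (suc m) ≡ (suc n , 0)
  step p rewrite p = refl

abstract
  pair : ℕ × ℕ → ℕ
  pair (n , k) = proj₁ (unpair-reaches (n + k) n k refl)

  unpair-pair : ∀ p → unpair (pair p) ≡ p
  unpair-pair (n , k) = proj₂ (unpair-reaches (n + k) n k refl)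

pair-injective : ∀ {p q} → pair p ≡ pair q → p ≡ q
pair-injective {p} {q} eq = trans (sym (unpair-pair p)) (trans (cong unpair eq) (unpair-pair q))

decode : ℕ → ℕ → ℕ → ℕ
decode zero    c i       = 0
decode (suc n) c zero    = proj₁ (unpair c)
decode (suc n) c (suc i) = decode n (proj₂ (unpair c)) i

-- Only finitely many terms are coded at a time, so countably many codes c suffice
-- for all initial segments of sequences: Baire space has a countable base.
decode-surjective : ∀ n (z : ℕ → ℕ) → ∃ λ c → ∀ i → i < n → z i ≡ decode n c i
decode-surjective zero    z = 0 , λ _ ()
decode-surjective (suc n) z with decode-surjective n (z ∘ suc)
... | c , agree = pair (z 0 , c) , λ where
  zero    _         → sym (cong proj₁ (unpair-pair (z 0 , c)))
  (suc i) (s≤s i<n) → trans (agree i i<n) (cong (λ p → decode n (proj₂ p) i) (sym (unpair-pair (z 0 , c))))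

-- Approximation in sequence spaces

infix 4 _≈[_]_
_≈[_]_ : (ℕ → Ω) → ℕ → (ℕ → Ω) → Set
z ≈[ n ] z′ = ∀ i → i < n → z i ≡ z′ i

≈-refl : {z : ℕ → Ω} → ∀ {n} → z ≈[ n ] z
≈-refl _ _ = refl

≈-sym : {z z′ : ℕ → Ω} → ∀ {n} → z ≈[ n ] z′ → z′ ≈[ n ] z
≈-sym p i i<n = sym (p i i<n)

≈-trans : {z z′ z″ : ℕ → Ω} → ∀ {n} → z ≈[ n ] z′ → z′ ≈[ n ] z″ → z ≈[ n ] z″
≈-trans p q i i<n = trans (p i i<n) (q i i<n)

≈-weaken : {z z′ : ℕ → Ω} → ∀ {m n} → m ≤ n → z ≈[ n ] z′ → z ≈[ m ] z′
≈-weaken m≤n p i i<m = p i (≤-trans i<m m≤n)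

-- Ideals and ultrafilters

module _ {𝒥 : Family Ω} (ideal : IsIdeal 𝒥) where
  open IsIdeal ideal

  ideal-⊆-∪ : ∀ {A} B C → A ⊆ˢ (B ∪ˢ C) → 𝒥 B → 𝒥 C → 𝒥 A
  ideal-⊆-∪ {A} B C A⊆ b c = ⊆-closed A (B ∪ˢ C) A⊆ (∪-closed B C b c)

ideal-⊆* : ∀ {𝒥} → IsIdeal 𝒥 → ∀ {A} B → A ⊆* B → 𝒥 B → 𝒥 A
ideal-⊆* ideal B A⊆*B b =
  ideal-⊆-∪ ideal (below _) B (⊆*⇒⊆-∪ A⊆*B) (IsIdeal.finite ideal (below _) (below-finite _)) b

module _ {𝒰 : Family ℕ} (uf : IsUltrafilter 𝒰) where
  open IsUltrafilter uf

  dual⇒∁ : ∀ {A} → (𝒰 *) A → 𝒰 (∁ˢ A)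
  dual⇒∁ {A} (B , b , A≗∁B) = ⊇-closed B (∁ˢ A) B⊆∁A b
    where
    B⊆∁A : B ⊆ˢ ∁ˢ A
    B⊆∁A {x} x∈B = T-absurd⇒not (A x) λ x∈A → T-contradiction (B x) x∈B (T-resp (A≗∁B x) x∈A)

  dual-disjoint : ∀ {A} → (𝒰 *) A → ¬ 𝒰 A
  dual-disjoint {A} a∈𝒰* a = proper (⊇-closed (A ∩ˢ ∁ˢ A) ∅ˢ empty (∩-closed A (∁ˢ A) a (dual⇒∁ a∈𝒰*)))
    where
    empty : (A ∩ˢ ∁ˢ A) ⊆ˢ ∅ˢ
    empty {x} t with ∩-elim A (∁ˢ A) t
    ... | p , q = T-contradiction (A x) p q

  ∁⇒dual : ∀ {A} → 𝒰 (∁ˢ A) → (𝒰 *) A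
  ∁⇒dual {A} ∁a = ∁ˢ A , ∁a , λ x → sym (not-involutive (A x))

  ∉⇒dual : ∀ {A} → ¬ 𝒰 A → (𝒰 *) A
  ∉⇒dual {A} ¬a with ultra A
  ... | inj₁ a  = contradiction a ¬a
  ... | inj₂ ∁a = ∁⇒dual ∁a

  dual-ideal : IsIdeal (𝒰 *)
  dual-ideal = record
    { ∪-closed = λ A B a b → ∁⇒dual (⊇-closed (∁ˢ A ∩ˢ ∁ˢ B) (∁ˢ (A ∪ˢ B)) (λ {x} → de-morgan A B x)
        (∩-closed (∁ˢ A) (∁ˢ B) (dual⇒∁ a) (dual⇒∁ b)))
    ; ⊆-closed = λ A B A⊆B b → ∉⇒dual λ a → dual-disjoint b (⊇-closed A B A⊆B a)
    ; finite   = λ A fin → ∁⇒dual (cofinite (∁ˢ A) (finite-⊆ (λ {x} → T-resp (not-involutive (A x))) fin))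
    ; proper   = λ full∈𝒰* → dual-disjoint full∈𝒰* (cofinite fullˢ ([] , λ _ ()))
    }
    where
    de-morgan : ∀ A B x → T ((∁ˢ A ∩ˢ ∁ˢ B) x) → T (∁ˢ (A ∪ˢ B) x)
    de-morgan A B x p with ∩-elim (∁ˢ A) (∁ˢ B) p
    ... | ∁a , ∁b = T-absurd⇒not ((A ∪ˢ B) x) λ a∪b → case ∪-elim A B a∪b of λ where
      (inj₁ a) → T-contradiction (A x) a ∁a
      (inj₂ b) → T-contradiction (B x) b ∁b

module Classical (em : ExcludedMiddle (lsuc 0ℓ)) where

  em₀ : ExcludedMiddle 0ℓ
  em₀ {P} = map′ lower lift (em {Lift (lsuc 0ℓ) P})

  by-contradiction : {P : Set} → ¬ ¬ P → P
  by-contradiction = decidable-stable em₀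

  ¬∀⇒∃¬ : {I : Set} {P : I → Set} → ¬ (∀ i → P i) → ∃ λ i → ¬ P i
  ¬∀⇒∃¬ ¬all = by-contradiction λ none → ¬all λ i → by-contradiction λ ¬p → none (i , ¬p)

  -- Resizes a large proposition, so that it may occur in the definition of a Family.
  ∥_∥ : Set₁ → Set
  ∥ P ∥ = True (em {P})

  abstract
    char : Pred Ω 0ℓ → Subset Ω
    char P x = isYes (em₀ {P x})

    char-intro : (P : Pred Ω 0ℓ) → ∀ {x} → P x → T (char P x)
    char-intro P = fromWitness

    char-elim : (P : Pred Ω 0ℓ) → ∀ {x} → T (char P x) → P x
    char-elim P = toWitness

  least : (P : ℕ → Set) → ∃ P → ∃ λ n → P n × ∀ m → P m → n ≤ m
  least P (n , p) = go n (<-wellFounded n) p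
    where
    go : ∀ n → Acc _<_ n → P n → ∃ λ n → P n × ∀ m → P m → n ≤ m
    go n (acc rs) p with em₀ {∃ λ m → m < n × P m}
    ... | yes (m , m<n , q) = go m (rs m<n) q
    ... | no  none          = n , p , λ m q → ≮⇒≥ λ m<n → none (m , m<n , q)

  -- Closed families and compactness

  -- In this form and its converse, closed means closed under limits of
  -- approximations.
  limit-closed : ∀ {𝒞} → IsClosed 𝒞 → ∀ A → (∀ n → ∃ λ B → A ≈[ n ] B × 𝒞 B) → 𝒞 A
  limit-closed closed A approx = by-contradiction λ A∉𝒞 →
    let n , nbhd       = closed A A∉𝒞
        B , A≈B , B∈𝒞 = approx n
    in nbhd B A≈B B∈𝒞

  closed-by-limits : ∀ {𝒞 : Family ℕ} → (∀ A → (∀ n → ∃ λ B → A ≈[ n ] B × 𝒞 B) → 𝒞 A) → IsClosed 𝒞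
  closed-by-limits limits A A∉𝒞 =
    let n , none = ¬∀⇒∃¬ λ approx → A∉𝒞 (limits A approx)
    in n , λ B A≈B B∈𝒞 → none (B , A≈B , B∈𝒞)

  closed-∪ : ∀ {𝒞 𝒟 : Family ℕ} → IsClosed 𝒞 → IsClosed 𝒟 → IsClosed (𝒞 ∪ 𝒟)
  closed-∪ c d A A∉ =
    let m , avoid₁ = c A (A∉ ∘ inj₁)
        n , avoid₂ = d A (A∉ ∘ inj₂)
    in m ⊔ n , λ B A≈B → λ where
      (inj₁ B∈𝒞) → avoid₁ B (≈-weaken (m≤m⊔n m n) A≈B) B∈𝒞
      (inj₂ B∈𝒟) → avoid₂ B (≈-weaken (m≤n⊔m m n) A≈B) B∈𝒟

  closed-⊆ : ∀ C → IsClosed (_⊆ˢ C)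
  closed-⊆ C = closed-by-limits λ A approx {x} x∈A →
    let B , A≈B , B⊆C = approx (suc x)
    in B⊆C (T-resp (A≈B x (n<1+n x)) x∈A)

  -- Sequential compactness of Cantor space.  Pass to terms of x whose first n
  -- values recur in infinitely many terms; if none of the later terms agreeing
  -- with x j below n also agrees with it at n, then they all agree with one
  -- another at n, since only two values are possible.
  convergent-subsequence : (x : ℕ → Subset ℕ) →
    ∃₂ λ y (φ : ℕ → ℕ) → ∀ n → n ≤ φ n × y ≈[ n ] x (φ n)
  convergent-subsequence x = y , φ , λ n →
    proj₁ (proj₂ (proj₂ (s n) n)) , ≈-trans (y≈ n) (proj₂ (proj₂ (proj₂ (s n) n)))
    where
    Recurrent : ℕ → ℕ → Set
    Recurrent n j = ∀ N → ∃ λ k → N ≤ k × x j ≈[ n ] x k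

    ≈-suc : ∀ {n} {a b : Subset ℕ} → a ≈[ n ] b → a n ≡ b n → a ≈[ suc n ] b
    ≈-suc p q i i<1+n = case m<1+n⇒m<n∨m≡n i<1+n of λ where
      (inj₁ i<n)  → p i i<n
      (inj₂ refl) → q

    third : ∀ {a b c : Bool} → ¬ a ≡ b → ¬ a ≡ c → b ≡ c
    third {true}  {true}          p q = contradiction refl p
    third {true}  {false} {true}  p q = contradiction refl q
    third {true}  {false} {false} p q = refl
    third {false} {false}         p q = contradiction refl p
    third {false} {true}  {false} p q = contradiction refl q
    third {false} {true}  {true}  p q = refl

    refine : ∀ n j → Recurrent n j → ∃ λ j′ → x j ≈[ n ] x j′ × Recurrent (suc n) j′
    refine n j rec with em₀ {Recurrent (suc n) j}
    ... | yes rec′ = j , ≈-refl , rec′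
    ... | no ¬rec′ =
      let N , none       = ¬∀⇒∃¬ ¬rec′
          k , N≤k , j≈k = rec N
      in k , j≈k , λ M →
        let k′ , le , j≈k′ = rec (M ⊔ N)
            N≤k′ = ≤-trans (m≤n⊔m M N) le
        in k′ , ≤-trans (m≤m⊔n M N) le ,
           ≈-suc (≈-trans (≈-sym j≈k) j≈k′)
             (third (λ e → none (k , N≤k , ≈-suc j≈k e)) (λ e → none (k′ , N≤k′ , ≈-suc j≈k′ e)))

    s : ∀ n → ∃ (Recurrent n)
    s zero    = 0 , λ N → N , ≤-refl , λ _ ()
    s (suc n) = let j , rec = s n ; j′ , _ , rec′ = refine n j rec in j′ , rec′

    coherent : ∀ {m n} → m ≤ n → x (proj₁ (s m)) ≈[ m ] x (proj₁ (s n))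
    coherent {m} {zero}  z≤n = ≈-refl
    coherent {m} {suc n} m≤1+n = case m≤n⇒m<n∨m≡n m≤1+n of λ where
      (inj₁ m<1+n) → let m≤n = m<1+n⇒m≤n m<1+n in
        ≈-trans (coherent m≤n) (≈-weaken m≤n (proj₁ (proj₂ (refine n (proj₁ (s n)) (proj₂ (s n))))))
      (inj₂ refl)  → ≈-refl

    y : Subset ℕ
    y i = x (proj₁ (s (suc i))) i

    φ : ℕ → ℕ
    φ n = proj₁ (proj₂ (s n) n)

    y≈ : ∀ n → y ≈[ n ] x (proj₁ (s n))
    y≈ n i i<n = coherent i<n i (n<1+n i)

  -- One step in generating an ideal.
  BelowUnions : Family ℕ → Family ℕ
  BelowUnions 𝒞 A = ∃₂ λ x y → 𝒞 x × 𝒞 y × A ⊆ˢ (x ∪ˢ y)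

  -- Compactness: if the approximations B n to A are covered by x n and y n, then A is
  -- covered by limits of x and y along a common subsequence.
  closed-BelowUnions : ∀ {𝒞} → IsClosed 𝒞 → IsClosed (BelowUnions 𝒞)
  closed-BelowUnions {𝒞} closed = closed-by-limits λ A approx →
    limit A (λ n → proj₁ (approx n)) (λ n → proj₁ (proj₂ (approx n))) (λ n → proj₂ (proj₂ (approx n)))
    where
    limit : ∀ A (B : ℕ → Subset ℕ) → (∀ n → A ≈[ n ] B n) → (∀ n → BelowUnions 𝒞 (B n)) → BelowUnions 𝒞 A
    limit A B A≈B B∈ with convergent-subsequence (λ n → proj₁ (B∈ n))
    ... | x∞ , φ , x→x∞ with convergent-subsequence (λ n → proj₁ (proj₂ (B∈ (φ n))))
    ...   | y∞ , ψ , y→y∞ =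
      x∞ , y∞ ,
      limit-closed closed x∞ (λ n → _ , proj₂ (x→x∞ n) , proj₁ (proj₂ (proj₂ (B∈ (φ n))))) ,
      limit-closed closed y∞ (λ n → _ , proj₂ (y→y∞ n) , proj₁ (proj₂ (proj₂ (proj₂ (B∈ (φ (ψ n))))))) ,
      λ {i} → A⊆ i
      where
      A⊆ : ∀ i → T (A i) → T ((x∞ ∪ˢ y∞) i)
      A⊆ i i∈A with y→y∞ (suc i)
      ... | i<n , y∞≈ with ψ (suc i)
      ...   | n with x→x∞ n
      ...     | n≤k , x∞≈ with φ n
      ...       | k with B∈ k | A≈B k
      ...         | x , y , _ , _ , B⊆ | A≈Bₖ =
        ∪-intro x∞ y∞ (⊎-map (T-resp (sym (x∞≈ i i<n))) (T-resp (sym (y∞≈ i (n<1+n i))))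
          (∪-elim x y (B⊆ (T-resp (A≈Bₖ i (≤-trans i<n n≤k)) i∈A))))

  -- The levels of the generated ideal stay closed because each arises from the
  -- preceding one by a single step BelowUnions.  The ambient ideal 𝒥 keeps it proper.
  Fσ-generates : ∀ {𝒥} → IsIdeal 𝒥 → (𝒞 : ℕ → Family ℕ) → (∀ n → IsClosed (𝒞 n)) → (∀ n → 𝒞 n ⊆ 𝒥) →
    ∃ λ 𝒥′ → IsIdeal 𝒥′ × IsFσ 𝒥′ × (∀ n → 𝒞 n ⊆ 𝒥′)
  Fσ-generates {𝒥} ideal 𝒞 closed 𝒞⊆𝒥 =
    ⋃ ℕ level , is-ideal , (level , level-closed , id , id) ,
    λ n {A} A∈𝒞 → suc n , A , A , inj₂ (inj₁ A∈𝒞) , inj₂ (inj₁ A∈𝒞) , ⊆-∪ A A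
    where
    module 𝒥 = IsIdeal ideal
    level : ℕ → Family ℕ
    level zero    = λ _ → ⊥
    level (suc n) = BelowUnions (level n ∪ (𝒞 n ∪ (_⊆ˢ below n)))

    level-closed : ∀ n → IsClosed (level n)
    level-closed zero    = λ A _ → 0 , λ _ _ ()
    level-closed (suc n) = closed-BelowUnions (closed-∪ (level-closed n) (closed-∪ (closed n) (closed-⊆ (below n))))

    level-⊆ : ∀ n → level n ⊆ 𝒥
    level-⊆ (suc n) (x , y , x∈ , y∈ , A⊆) = ideal-⊆-∪ ideal x y A⊆ (part x∈) (part y∈)
      where
      part : (level n ∪ (𝒞 n ∪ (_⊆ˢ below n))) ⊆ 𝒥
      part (inj₁ p)            = level-⊆ n p
      part (inj₂ (inj₁ p))     = 𝒞⊆𝒥 n p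
      part {A} (inj₂ (inj₂ p)) = 𝒥.finite A (finite-⊆ p (below-finite n))

    level-mono : ∀ {m n} → m ≤ n → level m ⊆ level n
    level-mono {m} {zero}  z≤n p = p
    level-mono {m} {suc n} m≤1+n {A} p = case m≤n⇒m<n∨m≡n m≤1+n of λ where
      (inj₁ m<1+n) → let q = level-mono (m<1+n⇒m≤n m<1+n) p in A , A , inj₁ q , inj₁ q , λ {x} → ⊆-∪ A A {x}
      (inj₂ refl)  → p

    is-ideal : IsIdeal (⋃ ℕ level)
    is-ideal = record
      { ∪-closed = λ A B (m , a) (n , b) → suc (m ⊔ n) , A , B ,
          inj₁ (level-mono (m≤m⊔n m n) a) , inj₁ (level-mono (m≤n⊔m m n) b) , id
      ; ⊆-closed = λ A B A⊆B (n , b) → suc n , B , B , inj₁ b , inj₁ b , ∪-intro B B ∘ inj₁ ∘ A⊆B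
      ; finite   = λ A fin → let N , A<N = finite⇒bounded A fin
                                 A⊆ = λ {x} x∈A → below-intro (A<N x x∈A)
                             in suc N , A , A , inj₂ (inj₂ A⊆) , inj₂ (inj₂ A⊆) , ⊆-∪ A A
      ; proper   = λ (n , full∈) → 𝒥.proper (level-⊆ n full∈)
      }

  -- Analytic families

  LimitClosed : (Subset ℕ → (ℕ → ℕ) → Set) → Set
  LimitClosed R = ∀ A w → (∀ n → ∃₂ λ A′ w′ → A ≈[ n ] A′ × w ≈[ n ] w′ × R A′ w′) → R A w

  -- The projection to Cantor space of a closed subset of its product with Baire
  -- space.
  Analytic : Family ℕ → Set₁
  Analytic 𝒮 = ∃ λ R → LimitClosed R × ∀ A → 𝒮 A ⇔ ∃ (R A)

  analytic-resp : ∀ {𝒮 𝒯 : Family ℕ} → 𝒮 ≐ 𝒯 → Analytic 𝒮 → Analytic 𝒯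
  analytic-resp (𝒮⊆𝒯 , 𝒯⊆𝒮) (R , lim , eqv) = R , lim , λ A → mk⇔ (to (eqv A) ∘ 𝒯⊆𝒮) (𝒮⊆𝒯 ∘ from (eqv A))

  analytic-closed : ∀ {𝒞} → IsClosed 𝒞 → Analytic 𝒞
  analytic-closed {𝒞} closed = (λ A _ → 𝒞 A) ,
    (λ A w approx → limit-closed closed A λ n → let A′ , _ , A≈A′ , _ , r = approx n in A′ , A≈A′ , r) ,
    λ A → mk⇔ (const 0 ,_) proj₂

  -- The witness names a basic neighbourhood contained in the open family.
  analytic-open : ∀ {𝒪} → IsOpen 𝒪 → Analytic 𝒪
  analytic-open {𝒪} open′ = R , lim , λ A →
    mk⇔ (λ A∈𝒪 → let n , nbhd = open′ A A∈𝒪 in const n , nbhd) λ (w , r) → r A ≈-refl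
    where
    R : Subset ℕ → (ℕ → ℕ) → Set
    R A w = ∀ B → A ≈[ w 0 ] B → 𝒪 B
    lim : LimitClosed R
    lim A w approx B A≈B with approx (suc (w 0))
    ... | A′ , w′ , A≈A′ , w≈w′ , r = r B (≈-weaken (≤-reflexive (sym (w≈w′ 0 (s≤s z≤n))))
                                            (≈-trans (≈-sym (≈-weaken (n≤1+n _) A≈A′)) A≈B))

  analytic-⋃ : {𝒮 : ℕ → Family ℕ} → (∀ n → Analytic (𝒮 n)) → Analytic (⋃ ℕ 𝒮)
  analytic-⋃ {𝒮} an = R , lim , λ A → mk⇔
    (λ (n , A∈) → let w , r = to (eqv n A) A∈ in (λ { zero → n ; (suc i) → w i }) , r)
    (λ (w , r) → w 0 , from (eqv (w 0) A) (w ∘ suc , r))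
    where
    eqv : ∀ n A → 𝒮 n A ⇔ ∃ (proj₁ (an n) A)
    eqv n = proj₂ (proj₂ (an n))
    R : Subset ℕ → (ℕ → ℕ) → Set
    R A w = proj₁ (an (w 0)) A (w ∘ suc)
    lim : LimitClosed R
    lim A w approx = proj₁ (proj₂ (an (w 0))) A (w ∘ suc) λ n →
      let A′ , w′ , A≈A′ , w≈w′ , r = approx (suc n)
      in A′ , w′ ∘ suc , ≈-weaken (n≤1+n n) A≈A′ , (λ i i<n → w≈w′ (suc i) (s≤s i<n)) ,
         subst (λ k → proj₁ (an k) A′ (w′ ∘ suc)) (sym (w≈w′ 0 (s≤s z≤n))) r

  -- One witness codes the witnesses for all members of the intersection.
  analytic-⋂ : {𝒮 : ℕ → Family ℕ} → (∀ n → Analytic (𝒮 n)) → Analytic (λ A → ∀ n → 𝒮 n A)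
  analytic-⋂ {𝒮} an = R , lim , λ A → mk⇔
    (λ A∈ → let w = λ n → proj₁ (to (eqv n A) (A∈ n)) in
      (λ x → uncurry w (unpair x)) , λ n → rlim n A _ λ m →
        A , w n , ≈-refl , (λ i _ → cong (uncurry w) (unpair-pair (n , i))) , proj₂ (to (eqv n A) (A∈ n)))
    (λ (w , r) n → from (eqv n A) (_ , r n))
    where
    Rₙ : ℕ → Subset ℕ → (ℕ → ℕ) → Set
    Rₙ n = proj₁ (an n)
    rlim : ∀ n → LimitClosed (Rₙ n)
    rlim n = proj₁ (proj₂ (an n))
    eqv : ∀ n A → 𝒮 n A ⇔ ∃ (Rₙ n A)
    eqv n = proj₂ (proj₂ (an n))
    R : Subset ℕ → (ℕ → ℕ) → Set
    R A w = ∀ n → Rₙ n A (λ k → w (pair (n , k)))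
    lim : LimitClosed R
    lim A w approx n = rlim n A (λ k → w (pair (n , k))) λ m →
      let N , codes<N = bound-below (λ k → pair (n , k)) m
          A′ , w′ , A≈A′ , w≈w′ , r = approx (m ⊔ N)
      in A′ , (λ k → w′ (pair (n , k))) , ≈-weaken (m≤m⊔n m N) A≈A′ ,
         (λ k k<m → w≈w′ (pair (n , k)) (≤-trans (codes<N k k<m) (m≤n⊔m m N))) , r n

  -- The complement has to be carried along for the induction to pass through
  -- complementation.
  borel⇒analytic : ∀ {𝒮} → Borel 𝒮 → Analytic 𝒮 × Analytic (∁ 𝒮)
  borel⇒analytic (open-set {𝒪} o) = analytic-open o , analytic-closed λ A ¬¬A∈𝒪 →
    let n , nbhd = o A (by-contradiction ¬¬A∈𝒪) in n , λ B A≈B B∉𝒪 → B∉𝒪 (nbhd B A≈B)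
  borel⇒analytic (complement b) with borel⇒analytic b
  ... | an , co = co , analytic-resp ((λ p ¬p → ¬p p) , by-contradiction) an
  borel⇒analytic (union bs) =
    analytic-⋃ (λ n → proj₁ (borel⇒analytic (bs n))) ,
    analytic-resp ((λ none (n , p) → none n p) , λ none n p → none (n , p))
      (analytic-⋂ λ n → proj₂ (borel⇒analytic (bs n)))
  borel⇒analytic (≐-resp (𝒮⊆𝒯 , 𝒯⊆𝒮) b) with borel⇒analytic b
  ... | an , co = analytic-resp (𝒮⊆𝒯 , 𝒯⊆𝒮) an , analytic-resp ((λ ∉𝒮 → ∉𝒮 ∘ 𝒯⊆𝒮) , λ ∉𝒯 → ∉𝒯 ∘ 𝒮⊆𝒯) co

  -- Separating an analytic family by an Fσ family

  Separated : Family ℕ → Family ℕ → Set₁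
  Separated 𝒮 𝒱 = ∃ λ (𝒞 : ℕ → Family ℕ) →
    (∀ n → IsClosed (𝒞 n)) × (∀ n A → 𝒞 n A → ¬ 𝒱 A) × (∀ A → 𝒮 A → ∃ λ n → 𝒞 n A)

  separated-⊆ : ∀ {𝒮 𝒯 𝒱 : Family ℕ} → 𝒯 ⊆ 𝒮 → Separated 𝒮 𝒱 → Separated 𝒯 𝒱
  separated-⊆ 𝒯⊆𝒮 (𝒞 , closed , avoid , cover) = 𝒞 , closed , avoid , λ A A∈𝒯 → cover A (𝒯⊆𝒮 A∈𝒯)

  separated-⋃ : ∀ {𝒮 : ℕ → Family ℕ} {𝒱} → (∀ n → Separated (𝒮 n) 𝒱) → Separated (⋃ ℕ 𝒮) 𝒱
  separated-⋃ {𝒮} {𝒱} sep =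
    uncurry 𝒞 ∘ unpair ,
    (λ m → let n , l = unpair m in proj₁ (proj₂ (sep n)) l) ,
    (λ m → let n , l = unpair m in proj₁ (proj₂ (proj₂ (sep n))) l) ,
    λ A (n , A∈) → let l , p = proj₂ (proj₂ (proj₂ (sep n))) A A∈ in
      pair (n , l) , subst (λ q → uncurry 𝒞 q A) (sym (unpair-pair (n , l))) p
    where
    𝒞 : ℕ → ℕ → Family ℕ
    𝒞 n = proj₁ (sep n)

  -- The assumption that 𝒮 and 𝒱 are not separated is exploited in the manner of the
  -- perfect set theorem: discard what is small and build branches in the rest.
  module Dichotomy (𝒮 : Family ℕ) (analytic : Analytic 𝒮) (𝒱 : Family ℕ) (¬sep : ¬ Separated 𝒮 𝒱) where

    R : Subset ℕ → (ℕ → ℕ) → Set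
    R = proj₁ analytic

    bit : Bool → ℕ
    bit false = 0
    bit true  = 1

    bit-injective : ∀ {b c} → bit b ≡ bit c → b ≡ c
    bit-injective {false} {false} _ = refl
    bit-injective {true}  {true}  _ = refl

    code : Subset ℕ → (ℕ → ℕ) → ℕ → ℕ
    code A w i = pair (bit (A i) , w i)

    code-injective : ∀ {A A′ w w′ n} → code A w ≈[ n ] code A′ w′ → A ≈[ n ] A′ × w ≈[ n ] w′
    code-injective p = (λ i i<n → bit-injective (cong proj₁ (pair-injective (p i i<n)))) ,
                       (λ i i<n → cong proj₂ (pair-injective (p i i<n)))

    code-cong : ∀ {A A′ w w′ n} → A ≈[ n ] A′ → w ≈[ n ] w′ → code A w ≈[ n ] code A′ w′
    code-cong p q i i<n = cong₂ (λ a b → pair (bit a , b)) (p i i<n) (q i i<n)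

    Neighbourhood : ℕ × ℕ → Subset ℕ → (ℕ → ℕ) → Set
    Neighbourhood (n , c) A w = code A w ≈[ n ] decode n c

    -- The jth basic neighbourhood of the product space.
    Node : ℕ → Subset ℕ → (ℕ → ℕ) → Set
    Node j = Neighbourhood (unpair j)

    node-of : ∀ A w n → ∃ λ j → Node j A w × ∀ A′ w′ → Node j A′ w′ → A ≈[ n ] A′ × w ≈[ n ] w′
    node-of A w n =
      let c , agree = decode-surjective n (code A w)
          at        = unpair-pair (n , c)
      in pair (n , c) , subst (λ p → Neighbourhood p A w) (sym at) agree ,
         λ A′ w′ in-node → code-injective
           (≈-trans agree (≈-sym (subst (λ p → Neighbourhood p A′ w′) at in-node)))

    Small : ℕ → Set₁
    Small j = Separated (λ A → ∃ λ w → R A w × Node j A w) 𝒱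

    Kernel : Subset ℕ → (ℕ → ℕ) → Set
    Kernel A w = R A w × ∀ j → Node j A w → ¬ ∥ Small j ∥

    -- Outside the kernel lie only countably many small pieces, each of which is
    -- separated from 𝒱 already.
    kernel-suffices : (Q : Subset ℕ → (ℕ → ℕ) → Set) →
      Separated (λ A → ∃ λ w → Kernel A w × Q A w) 𝒱 → Separated (λ A → ∃ λ w → R A w × Q A w) 𝒱
    kernel-suffices Q sepK = separated-⊆ cover (separated-⋃ {𝒮 = piece} sep)
      where
      piece : ℕ → Family ℕ
      piece zero    A = ∃ λ w → Kernel A w × Q A w
      piece (suc j) A = ∥ Small j ∥ × ∃ λ w → R A w × Node j A w

      sep : ∀ n → Separated (piece n) 𝒱
      sep zero    = sepK
      sep (suc j) with em {Small j}
      ... | yes small = separated-⊆ proj₂ small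
      ... | no _      = (λ _ _ → ⊥) , (λ _ _ _ → 0 , λ _ _ ()) , (λ _ _ ()) , λ _ ()

      cover : (λ A → ∃ λ w → R A w × Q A w) ⊆ ⋃ ℕ piece
      cover {A} (w , r , q) with em₀ {∃ λ j → Node j A w × ∥ Small j ∥}
      ... | yes (j , in-node , small) = suc j , small , w , r , in-node
      ... | no none                   = 0 , w , (r , λ j in-node small → none (j , in-node , small)) , q

    IsLimit : (Subset ℕ → (ℕ → ℕ) → Set) → Family ℕ
    IsLimit Q B = ∀ n → ∃₂ λ A w → B ≈[ n ] A × Kernel A w × Q A w

    -- Otherwise the closure of the kernel part would itself be a closed family avoiding
    -- 𝒱.
    limit-in-𝒱 : (Q : Subset ℕ → (ℕ → ℕ) → Set) →
      ¬ Separated (λ A → ∃ λ w → R A w × Q A w) 𝒱 → ∃ λ B → 𝒱 B × IsLimit Q B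
    limit-in-𝒱 Q ¬sepQ = by-contradiction λ none → ¬sepQ (kernel-suffices Q
      ( const (IsLimit Q)
      , (λ _ → closed-by-limits {IsLimit Q} λ B approx n →
          let B′ , B≈B′ , lim     = approx n
              A , w , B′≈A , rest = lim n
          in A , w , ≈-trans B≈B′ B′≈A , rest)
      , (λ _ B lim B∈𝒱 → none (B , B∈𝒱 , lim))
      , λ A (w , k , q) → 0 , λ _ → A , w , ≈-refl , k , q))

    -- The nodes of the tree in which the branches are built.
    Good : ℕ → Set
    Good j = ∃₂ λ A w → Kernel A w × Node j A w

    root : ∃ λ B → 𝒱 B × IsLimit (λ _ _ → ⊤) B
    root = limit-in-𝒱 (λ _ _ → ⊤) λ sep →
      ¬sep (separated-⊆ (λ {A} A∈𝒮 → let w , r = to (proj₂ (proj₂ analytic) A) A∈𝒮 in w , r , tt) sep)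

    good-root : ∃ Good
    good-root =
      let A , w , _ , k , _ = proj₂ (proj₂ root) 0
          j , in-node , _   = node-of A w 0
      in j , A , w , k , in-node

    -- At nodes off the tree the root value serves as a default, so that D is a sequence
    -- in 𝒱 indexed by all of ℕ.
    D-spec : ∀ j → ∃ λ B → 𝒱 B × (Good j → IsLimit (Node j) B)
    D-spec j with em₀ {Good j}
    ... | yes (A , w , k , in-node) =
      let B , B∈𝒱 , lim = limit-in-𝒱 (Node j) (λ sep → proj₂ k j in-node (fromWitness sep))
      in B , B∈𝒱 , const lim
    ... | no ¬good = proj₁ root , proj₁ (proj₂ root) , λ good → contradiction good ¬good

    D : ℕ → Subset ℕ
    D j = proj₁ (D-spec j)

    -- Below j′ the sets copy D j up to n, and the witnesses are determined up to n.
    Successor : ℕ → ℕ → ℕ → Set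
    Successor j n j′ = Good j′ ×
      (∀ A w → Node j′ A w → Node j A w × D j ≈[ n ] A) ×
      (∀ A w A′ w′ → Node j′ A w → Node j′ A′ w′ → w ≈[ n ] w′)

    successor : ∀ j n → Good j → ∃ (Successor j n)
    successor j n good =
      let A , w , D≈A , k , in-j = proj₂ (proj₂ (D-spec j)) good n
          l                      = proj₁ (unpair j)
          j′ , in-j′ , agree     = node-of A w (n ⊔ l)
          n≤                     = m≤m⊔n n l
          l≤                     = m≤n⊔m n l
      in j′ , (A , w , k , in-j′) ,
         (λ A′ w′ in′ → let A≈A′ , w≈w′ = agree A′ w′ in′ in
            ≈-trans (≈-sym (code-cong (≈-weaken l≤ A≈A′) (≈-weaken l≤ w≈w′))) in-j ,
            ≈-trans D≈A (≈-weaken n≤ A≈A′)) ,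
         (λ A′ w′ A″ w″ in′ in″ →
            ≈-trans (≈-sym (≈-weaken n≤ (proj₂ (agree A′ w′ in′)))) (≈-weaken n≤ (proj₂ (agree A″ w″ in″))))

    -- All points of the node J (suc i) agree with D (J i) below M i and with one another
    -- in their witnesses, so the branch converges to a point of the closed set R.
    branch : (J M : ℕ → ℕ) → (∀ i → i < M i) → (∀ i → Successor (J i) (M i) (J (suc i))) →
      ∃ λ c → 𝒮 c × ∀ i → D (J i) ≈[ M i ] c
    branch J M i<M succ = c , from (proj₂ (proj₂ analytic) c) (w , R-limit) , D≈c
      where
      A : ℕ → Subset ℕ
      A k = proj₁ (proj₁ (succ k))
      W : ℕ → ℕ → ℕ
      W k = proj₁ (proj₂ (proj₁ (succ k)))

      descend : ∀ {i k} → i ≤ k → ∀ {A w} → Node (J k) A w → Node (J i) A w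
      descend {i} {zero}  z≤n   p = p
      descend {i} {suc k} i≤1+k {A} {w} p = case m≤n⇒m<n∨m≡n i≤1+k of λ where
        (inj₁ i<1+k) → descend (m<1+n⇒m≤n i<1+k) (proj₁ (proj₁ (proj₂ (succ k)) A w p))
        (inj₂ refl)  → p

      in-node : ∀ {i k} → i ≤ k → Node (J (suc i)) (A k) (W k)
      in-node {i} {k} i≤k = descend (s≤s i≤k) (proj₂ (proj₂ (proj₂ (proj₁ (succ k)))))

      D≈A : ∀ {i k} → i ≤ k → D (J i) ≈[ M i ] A k
      D≈A {i} {k} i≤k = proj₂ (proj₁ (proj₂ (succ i)) (A k) (W k) (in-node i≤k))

      W≈W : ∀ {i k} → i ≤ k → W i ≈[ M i ] W k
      W≈W {i} {k} i≤k = proj₂ (proj₂ (succ i)) (A i) (W i) (A k) (W k) (in-node ≤-refl) (in-node i≤k)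

      -- Since x < M x, the value at x has settled by stage x.
      c : Subset ℕ
      c x = D (J x) x

      w : ℕ → ℕ
      w x = W x x

      R-limit : R c w
      R-limit = proj₁ (proj₂ analytic) c w λ n → A n , W n ,
        (λ x x<n → D≈A (<⇒≤ x<n) x (i<M x)) , (λ x x<n → W≈W (<⇒≤ x<n) x (i<M x)) ,
        proj₁ (proj₁ (proj₂ (proj₂ (proj₁ (succ n)))))

      D≈c : ∀ i → D (J i) ≈[ M i ] c
      D≈c i x x<Mi = trans (D≈A (m≤n⊔m x i) x x<Mi) (sym (D≈A (m≤m⊔n x i) x (i<M x)))

    double : ℕ → ℕ
    double zero    = zero
    double (suc n) = suc (suc (double n))

    n≤double : ∀ n → n ≤ double n
    n≤double zero    = z≤n
    n≤double (suc n) = s≤s (m≤n⇒m≤1+n (n≤double n))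

    parity : ∀ n → ∃ λ k → n ≡ double k ⊎ n ≡ suc (double k)
    parity zero    = 0 , inj₁ refl
    parity (suc n) with parity n
    ... | k , inj₁ eq = k , inj₂ (cong suc eq)
    ... | k , inj₂ eq = suc k , inj₁ (cong suc eq)

    locate : (m : ℕ → ℕ) → ∀ x k → m 0 ≤ x → x < m k → ∃ λ i → m i ≤ x × x < m (suc i)
    locate m x zero    m0≤x x<m0 = contradiction x<m0 (≤⇒≯ m0≤x)
    locate m x (suc k) m0≤x x<mk with x <? m k
    ... | yes x<m = locate m x k m0≤x x<m
    ... | no  x≮m = k , ≮⇒≥ x≮m , x<mk

    -- Stage i + 2 continues the branch of stage i, copying D (J i) below M i, and M (i + 1)
    -- is then chosen beyond the finite set where B is not contained in D (J (i + 2)).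
    -- So B is contained in the branch of that parity on the interval from M (i + 1) to
    -- M (i + 2), and these intervals exhaust a final segment of ℕ.
    covered-by-two : ∀ B → (∀ j → B ⊆* D j) → ∃₂ λ c c′ → 𝒮 c × 𝒮 c′ × B ⊆* (c ∪ˢ c′)
    covered-by-two B B⊆*D = c₀ , c₁ , proj₁ (proj₂ even) , proj₁ (proj₂ odd) , M 1 , λ x M1≤x x∈B →
      let i , Mi≤x , x<M = locate (M ∘ suc) x x M1≤x (<-trans (n<1+n x) (i<M (suc x)))
          x∈D            = proj₂ (B⊆*D (J (2 + i))) x (≤-trans (bound≤M i) Mi≤x) x∈B
      in ∪-intro c₀ c₁ (in-branch i x<M x∈D (parity i))
      where
      State : Set
      State = ∃ Good × ∃ Good × ℕ

      next : State → State
      next ((j , g) , g′ , m) =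
        let k , good , _ = successor j m g in g′ , (k , good) , suc (m ⊔ proj₁ (B⊆*D k))

      state : ℕ → State
      state zero    = good-root , good-root , 1
      state (suc i) = next (state i)

      J M : ℕ → ℕ
      J i = proj₁ (proj₁ (state i))
      M i = proj₂ (proj₂ (state i))

      J-succ : ∀ i → Successor (J i) (M i) (J (2 + i))
      J-succ i = let (j , g) , _ , m = state i in proj₂ (successor j m g)

      bound≤M : ∀ i → proj₁ (B⊆*D (J (2 + i))) ≤ M (suc i)
      bound≤M i = m≤n⇒m≤1+n (m≤n⊔m (M i) _)

      i<M : ∀ i → i < M i
      i<M zero    = s≤s z≤n
      i<M (suc i) = s≤s (≤-trans (i<M i) (m≤m⊔n (M i) _))

      even : ∃ λ c → 𝒮 c × ∀ i → D (J (double i)) ≈[ M (double i) ] c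
      even = branch (J ∘ double) (M ∘ double) (λ i → ≤-<-trans (n≤double i) (i<M (double i))) (J-succ ∘ double)

      odd : ∃ λ c → 𝒮 c × ∀ i → D (J (suc (double i))) ≈[ M (suc (double i)) ] c
      odd = branch (J ∘ suc ∘ double) (M ∘ suc ∘ double)
        (λ i → ≤-<-trans (m≤n⇒m≤1+n (n≤double i)) (i<M (suc (double i)))) (J-succ ∘ suc ∘ double)

      c₀ c₁ : Subset ℕ
      c₀ = proj₁ even
      c₁ = proj₁ odd

      in-branch : ∀ i {x} → x < M (2 + i) → T (D (J (2 + i)) x) → (∃ λ k → i ≡ double k ⊎ i ≡ suc (double k)) →
        T (c₀ x) ⊎ T (c₁ x)
      in-branch _ {x} x<M x∈D (k , inj₁ refl) = inj₁ (T-resp (proj₂ (proj₂ even) (suc k) x x<M) x∈D)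
      in-branch _ {x} x<M x∈D (k , inj₂ refl) = inj₂ (T-resp (proj₂ (proj₂ odd) (suc k) x x<M) x∈D)

  abstract
    covered-or-separated : ∀ {𝒮 𝒱 : Family ℕ} → Analytic 𝒮 → ¬ Separated 𝒮 𝒱 →
      ∃ λ (D : ℕ → Subset ℕ) → (∀ j → 𝒱 (D j)) ×
        ∀ B → (∀ j → B ⊆* D j) → ∃₂ λ c c′ → 𝒮 c × 𝒮 c′ × B ⊆* (c ∪ˢ c′)
    covered-or-separated {𝒮} {𝒱} analytic ¬sep = D , (λ j → proj₁ (proj₂ (D-spec j))) , covered-by-two
      where open Dichotomy 𝒮 analytic 𝒱 ¬sep

  -- P-points that are not ultrafilters for a Borel ideal

  HasPseudoIntersections : Family ℕ → Set
  HasPseudoIntersections 𝒱 = ∀ (D : ℕ → Subset ℕ) → (∀ j → 𝒱 (D j)) → ∃ λ B → 𝒱 B × ∀ j → B ⊆* D j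

  -- A separating Fσ family lies in the ideal 𝒱 *, where it generates an Fσ ideal.  In
  -- the other alternative a pseudo-intersection in 𝒱 of the countably many limits would be covered
  -- by two members of ℐ modulo a finite set.
  extends-to-Fσ : ∀ {ℐ 𝒱} → IsIdeal ℐ → Borel ℐ → IsUltrafilter 𝒱 → HasPseudoIntersections 𝒱 →
    ℐ ⊆ 𝒱 * → ExtendsToFσIdeal ℐ
  extends-to-Fσ {ℐ} {𝒱} ideal borel uf pseudo ℐ⊆𝒱* with em {Separated ℐ 𝒱}
  ... | yes (𝒞 , closed , avoid , cover) =
    let 𝒥 , 𝒥-ideal , 𝒥-Fσ , 𝒞⊆𝒥 = Fσ-generates (dual-ideal uf) 𝒞 closed (λ n {A} A∈𝒞 → ∉⇒dual uf (avoid n A A∈𝒞))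
    in 𝒥 , 𝒥-ideal , 𝒥-Fσ , λ {A} A∈ℐ → let n , A∈𝒞 = cover A A∈ℐ in 𝒞⊆𝒥 n A∈𝒞
  ... | no ¬sep = ⊥-elim (dual-disjoint uf (ℐ⊆𝒱* B∈ℐ) B∈𝒱)
    where
    open IsIdeal ideal

    limits = covered-or-separated (proj₁ (borel⇒analytic borel)) ¬sep

    pseudo-D : ∃ λ B → 𝒱 B × ∀ j → B ⊆* proj₁ limits j
    pseudo-D = pseudo (proj₁ limits) (proj₁ (proj₂ limits))

    B : Subset ℕ
    B = proj₁ pseudo-D

    B∈𝒱 : 𝒱 B
    B∈𝒱 = proj₁ (proj₂ pseudo-D)

    B∈ℐ : ℐ B
    B∈ℐ with proj₂ (proj₂ limits) B (proj₂ (proj₂ pseudo-D))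
    ... | c , c′ , c∈ℐ , c′∈ℐ , B⊆*c∪c′ = ideal-⊆* ideal (c ∪ˢ c′) B⊆*c∪c′ (∪-closed c c′ c∈ℐ c′∈ℐ)

  pushforward : (ℕ → ℕ) → Family ℕ → Family ℕ
  pushforward f 𝒰 A = 𝒰 (A ∘ f)

  pushforward-ultrafilter : ∀ {𝒰} → IsUltrafilter 𝒰 → (f : ℕ → ℕ) → (∀ A → Finite A → (𝒰 *) (A ∘ f)) →
    IsUltrafilter (pushforward f 𝒰)
  pushforward-ultrafilter {𝒰} uf f small = record
    { ∩-closed = λ A B → ∩-closed (A ∘ f) (B ∘ f)
    ; ⊇-closed = λ A B A⊆B → ⊇-closed (A ∘ f) (B ∘ f) A⊆B
    ; cofinite = λ A fin → case ultra (A ∘ f) of λ where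
        (inj₁ a)  → a
        (inj₂ ∁a) → contradiction ∁a (dual-disjoint uf (small (∁ˢ A) fin))
    ; proper   = proper
    ; ultra    = λ A → ultra (A ∘ f)
    }
    where open IsUltrafilter uf

  -- The image under f of a pseudo-intersection of the preimages D j ∘ f.  Only
  -- finitely many of its points escape D j, being images of finitely many points.
  pushforward-pseudo : ∀ {𝒰} → IsUltrafilter 𝒰 → IsPPoint 𝒰 → ∀ f → HasPseudoIntersections (pushforward f 𝒰)
  pushforward-pseudo {𝒰} uf p-point f D D∈ =
    image , ⊇-closed B (image ∘ f) (λ {x} x∈B → char-intro InImage (x , x∈B , refl)) B∈𝒰 , image⊆*
    where
    open IsUltrafilter uf
    𝒜 : Family ℕ
    𝒜 A = ∃ λ j → A ≗ ∁ˢ (D j ∘ f)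

    pseudo = p-point 𝒜 ((λ j → ∁ˢ (D j ∘ f)) , λ A (j , A≗) → j , λ x → sym (A≗ x)) λ (j , A≗) → D j ∘ f , D∈ j , A≗
    B   = proj₁ pseudo
    B∈𝒰 = proj₁ (proj₂ pseudo)

    InImage : Pred ℕ 0ℓ
    InImage y = ∃ λ x → T (B x) × f x ≡ y
    image : Subset ℕ
    image = char InImage

    image⊆* : ∀ j → image ⊆* D j
    image⊆* j with finite⇒bounded (∁ˢ (D j ∘ f) ∩ˢ B) (proj₂ (proj₂ pseudo) _ (j , λ _ → refl))
    ... | N , outside<N with bound-below f N
    ...   | M , f<M = M , λ y M≤y y∈image → inside y M≤y (char-elim InImage y∈image)
      where
      inside : ∀ y → M ≤ y → InImage y → T (D j y)
      inside _ M≤y (x , x∈B , refl) with T-dichotomy (D j (f x))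
      ... | inj₁ in-D = in-D
      ... | inj₂ out  = contradiction (f<M x (outside<N x (∩-intro (∁ˢ (D j ∘ f)) B out x∈B))) (≤⇒≯ M≤y)

  p-point⇒ultrafilter-for : ∀ {ℐ} → IsIdeal ℐ → Borel ℐ → ¬ ExtendsToFσIdeal ℐ →
    ∀ {𝒰} → IsUltrafilter 𝒰 → IsPPoint 𝒰 → IsUltrafilterFor ℐ 𝒰
  p-point⇒ultrafilter-for {ℐ} ideal borel ¬ext {𝒰} uf p-point (f , f-small) =
    ¬ext (extends-to-Fσ ideal borel uf′ (pushforward-pseudo uf p-point f)
      λ {A} A∈ℐ → ∉⇒dual uf′ (dual-disjoint uf (f-small A A∈ℐ)))
    where
    uf′ : IsUltrafilter (pushforward f 𝒰)
    uf′ = pushforward-ultrafilter uf f λ A fin → f-small A (IsIdeal.finite ideal A fin)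

  -- Ultrafilters that are not P-points

  ideal-⋃< : ∀ {𝒥 : Family ℕ} → IsIdeal 𝒥 → (A : ℕ → Subset ℕ) → (∀ n → 𝒥 (A n)) →
    ∀ M → 𝒥 (char λ x → ∃ λ n → n < M × T (A n x))
  ideal-⋃< {𝒥} ideal A A∈ = go
    where
    open IsIdeal ideal
    Initial : ℕ → Pred ℕ 0ℓ
    Initial M x = ∃ λ n → n < M × T (A n x)
    go : ∀ M → 𝒥 (char (Initial M))
    go zero    = finite _ ([] , λ x p → case char-elim (Initial zero) p of λ ())
    go (suc M) = ideal-⊆-∪ ideal (char (Initial M)) (A M)
      (λ {x} p → ∪-intro (char (Initial M)) (A M) (split x (char-elim (Initial (suc M)) p))) (go M) (A∈ M)
      where
      split : ∀ x → Initial (suc M) x → T (char (Initial M) x) ⊎ T (A M x)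
      split x (n , n<1+M , p) with m<1+n⇒m<n∨m≡n n<1+M
      ... | inj₁ n<M  = inj₁ (char-intro (Initial M) (n , n<M , p))
      ... | inj₂ refl = inj₂ p

  -- Adding the point n to the nth set makes the sets cover ℕ, so that each x has a
  -- first set A (column x) containing it; f x = (column x , x) then pulls Fin² back
  -- into 𝒰 *.  If instead the preimage of some S in Fin² belonged to 𝒰, then removing
  -- from it the sets of the exceptional columns would leave a set of 𝒰 with finite
  -- intersection with all A n.
  ≰Fin²⇒p-point : ∀ {𝒰} → IsUltrafilter 𝒰 → ¬ (Fin² ≤K 𝒰 *) → IsPPoint 𝒰
  ≰Fin²⇒p-point {𝒰} uf ¬≤K 𝒜 (e , enumerates) 𝒜⊆𝒰* = by-contradiction λ none → ¬≤K (f , λ S S∈ →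
      ∉⇒dual uf λ S∘f∈𝒰 → none (pseudo S S∈ S∘f∈𝒰))
    where
    open IsIdeal (dual-ideal uf)

    A-spec : ∀ n → ∃ λ A → (𝒰 *) A × ((𝒰 *) (e n) → e n ⊆ˢ A)
    A-spec n with em₀ {(𝒰 *) (e n)}
    ... | yes small = e n , small , λ _ → id
    ... | no ¬small = ∅ˢ , finite ∅ˢ ([] , λ _ ()) , λ small → contradiction small ¬small

    point : ℕ → Subset ℕ
    point n x = isYes (x ≟ n)

    A : ℕ → Subset ℕ
    A n = proj₁ (A-spec n) ∪ˢ point n

    A∈𝒰* : ∀ n → (𝒰 *) (A n)
    A∈𝒰* n = ∪-closed _ (point n) (proj₁ (proj₂ (A-spec n))) (finite (point n) (n ∷ [] , λ x p → here (toWitness p)))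

    column-spec : ∀ x → ∃ λ n → T (A n x) × ∀ m → T (A m x) → n ≤ m
    column-spec x = least (λ n → T (A n x)) (x , ∪-intro (proj₁ (A-spec x)) (point x) (inj₂ (fromWitness refl)))

    column : ℕ → ℕ
    column x = proj₁ (column-spec x)

    f : ℕ → ℕ × ℕ
    f x = column x , x

    -- If x lies in A n, then column x ≤ n; so the points of B in A n come from finitely
    -- many columns of S, and all of these are finite.
    pseudo : ∀ S → Fin² S → 𝒰 (S ∘ f) → ∃ λ B → 𝒰 B × ∀ C → 𝒜 C → Finite (C ∩ˢ B)
    pseudo S (ns , columns-finite) S∘f∈𝒰 = B , B∈𝒰 , fin
      where
      M = proj₁ (list-bound ns)

      InB : Pred ℕ 0ℓ
      InB x = T (S (f x)) × M ≤ column x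
      B : Subset ℕ
      B = char InB

      Early : Pred ℕ 0ℓ
      Early x = ∃ λ n → n < M × T (A n x)

      split : ∀ x → T (S (f x)) → T (B x) ⊎ T (char Early x)
      split x s with column x <? M
      ... | yes lt = inj₂ (char-intro Early (column x , lt , proj₁ (proj₂ (column-spec x))))
      ... | no ≮   = inj₁ (char-intro InB (s , ≮⇒≥ ≮))

      B∈𝒰 : 𝒰 B
      B∈𝒰 = by-contradiction λ B∉𝒰 → dual-disjoint uf (ideal-⊆-∪ (dual-ideal uf) B (char Early)
        (λ {x} s → ∪-intro B (char Early) (split x s)) (∉⇒dual uf B∉𝒰) (ideal-⋃< (dual-ideal uf) A A∈𝒰* M)) S∘f∈𝒰

      column-bound : ∀ n → ∃ λ N → M ≤ n → ∀ k → T (S (n , k)) → k < N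
      column-bound n with em₀ {n List.∈ ns}
      ... | yes n∈ns = 0 , λ M≤n → contradiction (proj₂ (list-bound ns) n n∈ns) (≤⇒≯ M≤n)
      ... | no  n∉ns = let N , below = finite⇒bounded _ (columns-finite n n∉ns) in N , λ _ → below

      fin : ∀ C → 𝒜 C → Finite (C ∩ˢ B)
      fin C C∈𝒜 with enumerates C C∈𝒜
      ... | n , e≗C with bound-below (proj₁ ∘ column-bound) (suc n)
      ...   | N , bounds<N = bounded⇒finite (C ∩ˢ B) (N , bound)
        where
        e∈𝒰* : (𝒰 *) (e n)
        e∈𝒰* = ⊆-closed (e n) C (≗⇒⊆ e≗C) (𝒜⊆𝒰* C∈𝒜)

        bound : ∀ x → T ((C ∩ˢ B) x) → x < N
        bound x p with ∩-elim C B p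
        ... | x∈C , x∈B with char-elim InB x∈B
        ...   | s , M≤column = <-trans (proj₂ (column-bound (column x)) M≤column x s)
                                 (bounds<N (column x) (s≤s (proj₂ (proj₂ (column-spec x)) n x∈A)))
          where
          x∈A : T (A n x)
          x∈A = ∪-intro (proj₁ (A-spec n)) (point n) (inj₁ (proj₂ (proj₂ (A-spec n)) e∈𝒰* (T-resp (sym (e≗C x)) x∈C)))

  ultrafilter-for⇒p-point : ∀ {ℐ} → ℐ ≤K Fin² → ∀ {𝒰} → IsUltrafilter 𝒰 → IsUltrafilterFor ℐ 𝒰 → IsPPoint 𝒰
  ultrafilter-for⇒p-point (g , g-small) uf ¬ℐ≤K = ≰Fin²⇒p-point uf λ (f , f-small) →
    ¬ℐ≤K (g ∘ f , λ B B∈ℐ → f-small (B ∘ g) (g-small B B∈ℐ))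

  -- Ultrafilters by recursion along a well-order of the continuum

  -- At stage A an X is selected that is compatible with the earlier selections, decides
  -- A and meets the requirement Q A.  CH makes the earlier selections countable, so
  -- that they are generated by a decreasing sequence.
  module Construction
    (ch : ContinuumHypothesis) (𝒥 : Family ℕ) (ideal : IsIdeal 𝒥) (Q : Subset ℕ → Family ℕ)
    (Q-resp : ∀ {A A′ X} → A ≗ A′ → Q A X → Q A′ X)
    (Q-down : ∀ {A X Y} → X ⊆ˢ Y → Q A Y → Q A X)
    (meet : ∀ A (D : ℕ → Subset ℕ) → (∀ n → D (suc n) ⊆ˢ D n) → (∀ n → ¬ 𝒥 (D n)) →
      ∃ λ X → Q A X × ∀ n → ¬ 𝒥 (D n ∩ˢ X))
    where

    open IsIdeal ideal

    infix 4 _≺_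
    _≺_ : Rel (Subset ℕ) 0ℓ
    _≺_ = proj₁ ch

    open IsStrictTotalOrder (proj₁ (proj₂ ch)) using (compare; <-resp-≈) renaming (trans to ≺-trans)

    wf : ∀ A → Acc _≺_ A
    wf = proj₁ (proj₂ (proj₂ ch))

    Least : Family ℕ → Family ℕ
    Least 𝒫 X = 𝒫 X × ∀ Y → Y ≺ X → ¬ 𝒫 Y

    least-exists : ∀ {𝒫 : Family ℕ} {X} → 𝒫 X → ∃ (Least 𝒫)
    least-exists {𝒫} {X} = go (wf X)
      where
      go : ∀ {X} → Acc _≺_ X → 𝒫 X → ∃ (Least 𝒫)
      go {X} (acc rs) p with em₀ {∃ λ Y → Y ≺ X × 𝒫 Y}
      ... | yes (Y , Y≺X , q) = go (rs Y≺X) q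
      ... | no none           = X , p , λ Y Y≺X q → none (Y , Y≺X , q)

    least-unique : ∀ {𝒫 X Y} → Least 𝒫 X → Least 𝒫 Y → X ≗ Y
    least-unique {X = X} {Y} (p , minX) (q , minY) with compare X Y
    ... | tri< X≺Y _ _ = contradiction p (minY X X≺Y)
    ... | tri≈ _ X≗Y _ = X≗Y
    ... | tri> _ _ Y≺X = contradiction q (minX Y Y≺X)

    -- The filter generated by ℱ and X avoids 𝒥.
    Compatible : Family ℕ → Family ℕ
    Compatible ℱ X = ∀ Ys → All ℱ Ys → ¬ 𝒥 (⋂ˢ Ys ∩ˢ X)

    Good : Family ℕ → Subset ℕ → Family ℕ
    Good ℱ A X = Compatible ℱ X × (X ⊆ˢ A ⊎ X ⊆ˢ ∁ˢ A) × Q A X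

    good-resp : ∀ {ℱ ℱ′ : Family ℕ} {A A′} → ℱ′ ⊆ ℱ → A ≗ A′ → Good ℱ A ⊆ Good ℱ′ A′
    good-resp {A = A} {A′} ℱ′⊆ℱ A≗A′ {X} (compatible , decides , q) =
      (λ Ys Ys∈ → compatible Ys (All-map ℱ′⊆ℱ Ys∈)) ,
      ⊎-map (λ X⊆A {x} x∈X → T-resp (A≗A′ x) (X⊆A x∈X))
            (λ X⊆∁A {x} x∈X → T-resp (cong not (A≗A′ x)) (X⊆∁A x∈X)) decides ,
      Q-resp A≗A′ q

    -- Taking the ≺-least good set, rather than an arbitrary choice of one, makes the
    -- selection depend only on the extension of the earlier selections, and hence not on
    -- the proof of accessibility.
    SelectedAcc : ∀ {A} → Acc _≺_ A → Family ℕ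
    SelectedAcc {A} (acc rs) = Least (Good (λ Y → ∃ λ B → Σ (B ≺ A) λ B≺A → SelectedAcc (rs B≺A) Y) A)

    selected-⊆ : ∀ {A A′} → A ≗ A′ → (p : Acc _≺_ A) (q : Acc _≺_ A′) → SelectedAcc p ⊆ SelectedAcc q
    selected-⊆ {A} {A′} A≗A′ (acc rs) (acc rs′) (good , min) =
      good-resp (λ (B , lt , s) → B , back lt , selected-⊆ (λ _ → refl) (rs′ lt) (rs (back lt)) s) A≗A′ good ,
      λ Y Y≺X g → min Y Y≺X
        (good-resp (λ (B , lt , s) → B , forth lt , selected-⊆ (λ _ → refl) (rs lt) (rs′ (forth lt)) s) (λ x → sym (A≗A′ x)) g)
      where
      forth : ∀ {B} → B ≺ A → B ≺ A′
      forth = proj₁ <-resp-≈ A≗A′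
      back : ∀ {B} → B ≺ A′ → B ≺ A
      back = proj₁ <-resp-≈ (λ x → sym (A≗A′ x))

    Selected : Subset ℕ → Family ℕ
    Selected A = SelectedAcc (wf A)

    Before : Subset ℕ → Family ℕ
    Before A Y = ∃ λ B → B ≺ A × Selected B Y

    selected⇔least : ∀ A → Selected A ≐ Least (Good (Before A) A)
    selected⇔least A = unfold (wf A)
      where
      unfold : (p : Acc _≺_ A) → SelectedAcc p ≐ Least (Good (Before A) A)
      unfold (acc rs) =
        (λ (g , min) → good-resp to-acc (λ _ → refl) g , λ Y lt h → min Y lt (good-resp from-acc (λ _ → refl) h)) ,
        (λ (g , min) → good-resp from-acc (λ _ → refl) g , λ Y lt h → min Y lt (good-resp to-acc (λ _ → refl) h))
        where
        to-acc : Before A ⊆ (λ Y → ∃ λ B → Σ (B ≺ A) λ B≺A → SelectedAcc (rs B≺A) Y)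
        to-acc (B , lt , s) = B , lt , selected-⊆ (λ _ → refl) (wf B) (rs lt) s
        from-acc : (λ Y → ∃ λ B → Σ (B ≺ A) λ B≺A → SelectedAcc (rs B≺A) Y) ⊆ Before A
        from-acc (B , lt , s) = B , lt , selected-⊆ (λ _ → refl) (rs lt) (wf B) s

    selected-good : ∀ {A X} → Selected A X → Good (Before A) A X
    selected-good {A} s = proj₁ (proj₁ (selected⇔least A) s)

    selected-unique : ∀ {A B X Y} → A ≗ B → Selected A X → Selected B Y → X ≗ Y
    selected-unique {A} {B} A≗B s t =
      least-unique (proj₁ (selected⇔least B) (selected-⊆ A≗B (wf A) (wf B) s)) (proj₁ (selected⇔least B) t)

    AnySelected : Family ℕ
    AnySelected Y = ∃ λ A → Selected A Y

    -- The set selected at the latest of the finitely many stages is compatible with the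
    -- others, whence finite intersections of selected sets stay outside 𝒥.
    top : ∀ Y Ys → All AnySelected (Y ∷ Ys) → ∃₂ λ A X → ∃ λ Zs →
      Selected A X × All (Before A) Zs × (⋂ˢ Zs ∩ˢ X) ⊆ˢ ⋂ˢ (Y ∷ Ys)
    top Y [] ((B , s) ∷ []) = B , Y , [] , s , [] , λ {x} y → ∩-intro Y fullˢ {x} y tt
    top Y (Y′ ∷ Ys) ((B , s) ∷ rest) with top Y′ Ys rest
    ... | A , X , Zs , t , Zs∈ , ⊆Ys with compare A B
    ...   | tri< A≺B _ _ = B , Y , X ∷ Zs , s , (A , A≺B , t) ∷ All-map (λ (C , C≺A , u) → C , ≺-trans C≺A A≺B , u) Zs∈ ,
      λ {x} p → let q , y = ∩-elim (X ∩ˢ ⋂ˢ Zs) Y {x} p ; x∈X , zs = ∩-elim X (⋂ˢ Zs) {x} q in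
        ∩-intro Y (⋂ˢ (Y′ ∷ Ys)) {x} y (⊆Ys (∩-intro (⋂ˢ Zs) X {x} zs x∈X))
    ...   | tri≈ _ A≗B _ = A , X , Zs , t , Zs∈ ,
      λ {x} p → ∩-intro Y (⋂ˢ (Y′ ∷ Ys)) {x}
        (T-resp (selected-unique A≗B t s x) (proj₂ (∩-elim (⋂ˢ Zs) X {x} p))) (⊆Ys p)
    ...   | tri> _ _ B≺A = A , X , Y ∷ Zs , t , (B , B≺A , s) ∷ Zs∈ ,
      λ {x} p → let q , x∈X = ∩-elim (Y ∩ˢ ⋂ˢ Zs) X {x} p ; y , zs = ∩-elim Y (⋂ˢ Zs) {x} q in
        ∩-intro Y (⋂ˢ (Y′ ∷ Ys)) {x} y (⊆Ys (∩-intro (⋂ˢ Zs) X {x} zs x∈X))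

    positive-intersections : ∀ Ys → All AnySelected Ys → ¬ 𝒥 (⋂ˢ Ys)
    positive-intersections []       _   = proper
    positive-intersections (Y ∷ Ys) Ys∈ with top Y Ys Ys∈
    ... | A , X , Zs , s , Zs∈ , ⊆Ys = λ small → proj₁ (selected-good s) Zs Zs∈ (⊆-closed _ _ ⊆Ys small)

    -- The intersections D n of the first n earlier selections are cofinal among all finite
    -- intersections; a set meeting the requirement below D is then split by A, and one
    -- half must remain positive.
    selection-exists : ∀ A → ∃ (Selected A)
    selection-exists A =
      let X , q , positive = meet A D (D-decreasing) (λ n → positive-intersections (proj₁ (Zs n)) (All-map before⇒any (proj₂ (Zs n))))
          X′ , good        = decide X q positive
          X″ , least′      = least-exists good
      in X″ , proj₂ (selected⇔least A) least′
      where
      e : ℕ → Subset ℕ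
      e = proj₁ (proj₂ (proj₂ (proj₂ ch)) A)

      before⇒any : Before A ⊆ AnySelected
      before⇒any (B , _ , s) = B , s

      -- The enumeration e may leave the initial segment below A; such indices contribute
      -- nothing.
      At : ℕ → Set
      At n = ∃₂ λ B Y → B ≗ e n × B ≺ A × Selected B Y

      Zs : ∀ n → ∃ (All (Before A))
      Zs zero = [] , []
      Zs (suc n) with em₀ {At n}
      ... | yes (B , Y , _ , B≺A , s) = Y ∷ proj₁ (Zs n) , (B , B≺A , s) ∷ proj₂ (Zs n)
      ... | no _                      = Zs n

      D : ℕ → Subset ℕ
      D n = ⋂ˢ (proj₁ (Zs n))

      D-decreasing : ∀ n → D (suc n) ⊆ˢ D n
      D-decreasing n p with em₀ {At n}
      ... | yes (B , Y , _) = proj₂ (∩-elim Y (D n) p)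
      ... | no _            = p

      D-antitone : ∀ {m n} → m ≤ n → D n ⊆ˢ D m
      D-antitone = decreasing⇒antitone D D-decreasing

      cofinal : ∀ {Y} → Before A Y → ∃ λ n → D n ⊆ˢ Y
      cofinal {Y} (B , B≺A , s) with proj₂ (proj₂ (proj₂ (proj₂ ch)) A) B B≺A
      ... | n , e≗B = suc n , λ {x} → inside x
        where
        inside : ∀ x → T (D (suc n) x) → T (Y x)
        inside x p with em₀ {At n}
        ... | yes (B′ , Y′ , B′≗e , _ , s′) =
          T-resp (selected-unique (λ i → trans (B′≗e i) (e≗B i)) s′ s x) (proj₁ (∩-elim Y′ (D n) p))
        ... | no none = contradiction (B , Y , (λ i → sym (e≗B i)) , B≺A , s) none

      cofinal-list : ∀ Ys → All (Before A) Ys → ∃ λ n → D n ⊆ˢ ⋂ˢ Ys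
      cofinal-list []       []         = 0 , λ _ → tt
      cofinal-list (Y ∷ Ys) (y∈ ∷ ys∈) =
        let m , D⊆Y  = cofinal y∈
            n , D⊆Ys = cofinal-list Ys ys∈
        in m ⊔ n , λ p → ∩-intro Y (⋂ˢ Ys) (D⊆Y (D-antitone (m≤m⊔n m n) p)) (D⊆Ys (D-antitone (m≤n⊔m m n) p))

      compatible : ∀ X → (∀ n → ¬ 𝒥 (D n ∩ˢ X)) → Compatible (Before A) X
      compatible X positive Ys Ys∈ small with cofinal-list Ys Ys∈
      ... | n , D⊆ = positive n (⊆-closed (D n ∩ˢ X) (⋂ˢ Ys ∩ˢ X)
        (λ p → let d , x = ∩-elim (D n) X p in ∩-intro (⋂ˢ Ys) X (D⊆ d) x) small)

      decide : ∀ X → Q A X → (∀ n → ¬ 𝒥 (D n ∩ˢ X)) → ∃ (Good (Before A) A)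
      decide X q positive with em₀ {∀ n → ¬ 𝒥 (D n ∩ˢ (X ∩ˢ A))}
      ... | yes positive′ = X ∩ˢ A , compatible _ positive′ , inj₁ (proj₂ ∘ ∩-elim X A) , Q-down (proj₁ ∘ ∩-elim X A) q
      ... | no ¬positive  = X ∩ˢ ∁ˢ A , compatible _ positive′ , inj₂ (proj₂ ∘ ∩-elim X (∁ˢ A)) , Q-down (proj₁ ∘ ∩-elim X (∁ˢ A)) q
        where
        m = proj₁ (¬∀⇒∃¬ ¬positive)
        small : 𝒥 (D m ∩ˢ (X ∩ˢ A))
        small = by-contradiction (proj₂ (¬∀⇒∃¬ ¬positive))

        positive′ : ∀ n → ¬ 𝒥 (D n ∩ˢ (X ∩ˢ ∁ˢ A))
        positive′ n small′ = positive (m ⊔ n)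
          (ideal-⊆-∪ ideal (D m ∩ˢ (X ∩ˢ A)) (D n ∩ˢ (X ∩ˢ ∁ˢ A)) (λ {x} → split x) small small′)
          where
          split : ∀ x → T ((D (m ⊔ n) ∩ˢ X) x) → T (((D m ∩ˢ (X ∩ˢ A)) ∪ˢ (D n ∩ˢ (X ∩ˢ ∁ˢ A))) x)
          split x p with ∩-elim (D (m ⊔ n)) X p
          ... | d , x∈X = ∪-intro (D m ∩ˢ (X ∩ˢ A)) (D n ∩ˢ (X ∩ˢ ∁ˢ A)) (case T-dichotomy (A x) of λ where
            (inj₁ a)  → inj₁ (∩-intro (D m) (X ∩ˢ A) (D-antitone (m≤m⊔n m n) d) (∩-intro X A x∈X a))
            (inj₂ ∁a) → inj₂ (∩-intro (D n) (X ∩ˢ ∁ˢ A) (D-antitone (m≤n⊔m m n) d) (∩-intro X (∁ˢ A) x∈X ∁a)))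

    𝒰 : Family ℕ
    𝒰 Y = ∃ λ Ys → All AnySelected Ys × ⋂ˢ Ys ⊆ˢ Y

    𝒰-positive : ∀ A → 𝒥 A → ¬ 𝒰 A
    𝒰-positive A small (Ys , Ys∈ , ⊆A) = positive-intersections Ys Ys∈ (⊆-closed (⋂ˢ Ys) A ⊆A small)

    selected⇒𝒰 : ∀ {A X Y} → Selected A X → X ⊆ˢ Y → 𝒰 Y
    selected⇒𝒰 {A} {X} s X⊆Y = X ∷ [] , (A , s) ∷ [] , λ {x} p → X⊆Y (proj₁ (∩-elim X fullˢ {x} p))

    𝒰-ultra : ∀ A → 𝒰 A ⊎ 𝒰 (∁ˢ A)
    𝒰-ultra A with selection-exists A
    ... | X , s with proj₁ (proj₂ (selected-good s))
    ...   | inj₁ X⊆A  = inj₁ (selected⇒𝒰 s X⊆A)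
    ...   | inj₂ X⊆∁A = inj₂ (selected⇒𝒰 s X⊆∁A)

    𝒰-ultrafilter : IsUltrafilter 𝒰
    𝒰-ultrafilter = record
      { ∩-closed = λ A B (As , As∈ , ⊆A) (Bs , Bs∈ , ⊆B) → As ++ Bs , ++⁺ As∈ Bs∈ , λ p →
          let as , bs = ∩-elim (⋂ˢ As) (⋂ˢ Bs) (⋂-++ As Bs p) in ∩-intro A B (⊆A as) (⊆B bs)
      ; ⊇-closed = λ A B A⊆B (As , As∈ , ⊆A) → As , As∈ , λ p → A⊆B (⊆A p)
      ; cofinite = λ A fin → case 𝒰-ultra A of λ where
          (inj₁ a)  → a
          (inj₂ ∁a) → contradiction ∁a (𝒰-positive (∁ˢ A) (finite (∁ˢ A) fin))
      ; proper   = 𝒰-positive ∅ˢ (finite ∅ˢ ([] , λ _ ()))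
      ; ultra    = 𝒰-ultra
      }

    𝒰-meets : ∀ A → ∃ λ X → 𝒰 X × Q A X
    𝒰-meets A with selection-exists A
    ... | X , s = X , selected⇒𝒰 s id , proj₂ (proj₂ (selected-good s))

  abstract
    meeting-ultrafilter : ContinuumHypothesis → ∀ {𝒥} → IsIdeal 𝒥 → (Q : Subset ℕ → Family ℕ) →
      (∀ {A A′ X} → A ≗ A′ → Q A X → Q A′ X) →
      (∀ {A X Y} → X ⊆ˢ Y → Q A Y → Q A X) →
      (∀ A (D : ℕ → Subset ℕ) → (∀ n → D (suc n) ⊆ˢ D n) → (∀ n → ¬ 𝒥 (D n)) →
        ∃ λ X → Q A X × ∀ n → ¬ 𝒥 (D n ∩ˢ X)) →
      ∃ λ 𝒰 → IsUltrafilter 𝒰 × (∀ A → 𝒥 A → ¬ 𝒰 A) × ∀ A → ∃ λ X → 𝒰 X × Q A X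
    meeting-ultrafilter ch {𝒥} ideal Q Q-resp Q-down meet = 𝒰 , 𝒰-ultrafilter , 𝒰-positive , 𝒰-meets
      where open Construction ch 𝒥 ideal Q Q-resp Q-down meet

  -- P-points disjoint from a given Fσ ideal

  abstract
    -- The finitary core of the argument that quotients by Fσ ideals are countably closed:
    -- a finite part of A already fails to be contained in any member of 𝒞.
    finite-escape : ∀ {𝒞} → IsClosed 𝒞 → ∀ A → ¬ BelowUnions 𝒞 A →
      ∃ λ m → ∀ Y → 𝒞 Y → ¬ ((A ∩ˢ below m) ⊆ˢ Y)
    finite-escape {𝒞} closed A A∉ = restrict (closed-BelowUnions {𝒞} closed A A∉)
      where
      ∧-absorb : ∀ b {c} → T c → b ≡ b ∧ c
      ∧-absorb true  {true} _ = refl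
      ∧-absorb false        _ = refl

      restrict : (∃ λ m → ∀ B → A ≈[ m ] B → ¬ BelowUnions 𝒞 B) → ∃ λ m → ∀ Y → 𝒞 Y → ¬ ((A ∩ˢ below m) ⊆ˢ Y)
      restrict (m , avoid) = m , λ Y Y∈𝒞 A⊆Y →
        avoid (A ∩ˢ below m) (λ i i<m → ∧-absorb (A i) {below m i} (below-intro i<m))
          (Y , Y , Y∈𝒞 , Y∈𝒞 , λ {x} p → ⊆-∪ Y Y {x} (A⊆Y {x} p))

  -- From D n take a finite part contained in no member of the nth closed set.  The union
  -- of these parts escapes every closed set constituting 𝒥, and all but the first n
  -- parts lie in D n.
  positive-pseudo-intersection : ∀ {𝒥} → IsIdeal 𝒥 → IsFσ 𝒥 → (D : ℕ → Subset ℕ) →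
    (∀ n → D (suc n) ⊆ˢ D n) → (∀ n → ¬ 𝒥 (D n)) → ∃ λ X → ¬ 𝒥 X × ∀ n → X ⊆* D n
  positive-pseudo-intersection {𝒥} ideal (𝒞 , closed , 𝒥⊆⋃ , ⋃⊆𝒥) D decreasing positive = X , X∉𝒥 , X⊆*D
    where
    open IsIdeal ideal

    escape : ∀ n → ∃ λ m → ∀ Y → 𝒞 n Y → ¬ ((D n ∩ˢ below m) ⊆ˢ Y)
    escape n = finite-escape (closed n) (D n) λ (x , y , x∈ , y∈ , D⊆) →
      positive n (ideal-⊆-∪ ideal x y D⊆ (⋃⊆𝒥 (n , x∈)) (⋃⊆𝒥 (n , y∈)))

    m : ℕ → ℕ
    m n = proj₁ (escape n)

    InX : Pred ℕ 0ℓ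
    InX x = ∃ λ n → T (D n x) × x < m n
    X : Subset ℕ
    X = char InX

    X∉𝒥 : ¬ 𝒥 X
    X∉𝒥 X∈𝒥 with 𝒥⊆⋃ X∈𝒥
    ... | n , X∈𝒞 = proj₂ (escape n) X X∈𝒞 λ {x} p →
      let d , lt = ∩-elim (D n) (below (m n)) {x} p in char-intro InX (n , d , below-elim lt)

    antitone : ∀ {k n} → k ≤ n → D n ⊆ˢ D k
    antitone = decreasing⇒antitone D decreasing

    X⊆*D : ∀ n → X ⊆* D n
    X⊆*D n with bound-below m n
    ... | N , m<N = N , λ x N≤x x∈X → inside x N≤x (char-elim InX x∈X)
      where
      inside : ∀ x → N ≤ x → InX x → T (D n x)
      inside x N≤x (k , d , x<m) with k <? n
      ... | yes k<n = contradiction (<-trans x<m (m<N k k<n)) (≤⇒≯ N≤x)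
      ... | no  k≮n = antitone (≮⇒≥ k≮n) d

  row : Subset ℕ → ℕ → Subset ℕ
  row A n k = A (pair (n , k))

  -- The requirement for P-points, with A coding the sequence of its rows: a member X
  -- of the ultrafilter shows that some row is not a member, or else it is a
  -- pseudo-intersection of all rows.
  SplitsOrPseudo : Subset ℕ → Family ℕ
  SplitsOrPseudo A X = (∃ λ n → X ⊆ˢ ∁ˢ (row A n)) ⊎ (∀ n → X ⊆* row A n)

  -- If the complement of some row is positive below D, it can be taken for X.  Otherwise
  -- each row contains some D m modulo 𝒥, so D can be intersected with the rows one by
  -- one and remains positive.
  meet-SplitsOrPseudo : ∀ {𝒥} → IsIdeal 𝒥 → IsFσ 𝒥 → ∀ A (D : ℕ → Subset ℕ) →
    (∀ n → D (suc n) ⊆ˢ D n) → (∀ n → ¬ 𝒥 (D n)) → ∃ λ X → SplitsOrPseudo A X × ∀ n → ¬ 𝒥 (D n ∩ˢ X)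
  meet-SplitsOrPseudo {𝒥} ideal Fσ A D decreasing positive
    with em₀ {∃ λ i → ∀ m → ¬ 𝒥 (D m ∩ˢ ∁ˢ (row A i))}
  ... | yes (i , pos) = ∁ˢ (row A i) , inj₁ (i , id) , pos
  ... | no  none      = X , inj₂ X⊆*row , D∩X∉𝒥
    where
    open IsIdeal ideal

    antitone : ∀ {k n} → k ≤ n → D n ⊆ˢ D k
    antitone = decreasing⇒antitone D decreasing

    almost : ∀ i → ∃ λ m → 𝒥 (D m ∩ˢ ∁ˢ (row A i))
    almost i with ¬∀⇒∃¬ (λ pos → none (i , pos))
    ... | m , ¬¬small = m , by-contradiction ¬¬small

    C E : ℕ → Subset ℕ
    C zero    = fullˢ
    C (suc n) = C n ∩ˢ row A n
    E n = D n ∩ˢ C n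

    almost-C : ∀ n → ∃ λ m → 𝒥 (D m ∩ˢ ∁ˢ (C n))
    almost-C zero = 0 , finite _ ([] , λ x p → ⊥-elim (proj₂ (∩-elim (D 0) (∁ˢ fullˢ) {x} p)))
    almost-C (suc n) =
      let k , k-small = almost-C n
          l , l-small = almost n
      in k ⊔ l , ideal-⊆-∪ ideal (D k ∩ˢ ∁ˢ (C n)) (D l ∩ˢ ∁ˢ (row A n)) (λ {x} → split k l x) k-small l-small
      where
      split : ∀ k l x → T ((D (k ⊔ l) ∩ˢ ∁ˢ (C (suc n))) x) → T (((D k ∩ˢ ∁ˢ (C n)) ∪ˢ (D l ∩ˢ ∁ˢ (row A n))) x)
      split k l x p with ∩-elim (D (k ⊔ l)) (∁ˢ (C (suc n))) p | T-dichotomy (C n x) | T-dichotomy (row A n x)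
      ... | d , ∁c | inj₁ c  | inj₁ a  = ⊥-elim (T-contradiction (C (suc n) x) (∩-intro (C n) (row A n) c a) ∁c)
      ... | d , _  | inj₂ ¬c | _       = ∪-intro (D k ∩ˢ ∁ˢ (C n)) (D l ∩ˢ ∁ˢ (row A n)) (inj₁ (∩-intro (D k) (∁ˢ (C n)) (antitone (m≤m⊔n k l) d) ¬c))
      ... | d , _  | inj₁ _  | inj₂ ¬a = ∪-intro (D k ∩ˢ ∁ˢ (C n)) (D l ∩ˢ ∁ˢ (row A n)) (inj₂ (∩-intro (D l) (∁ˢ (row A n)) (antitone (m≤n⊔m k l) d) ¬a))

    E∉𝒥 : ∀ n → ¬ 𝒥 (E n)
    E∉𝒥 n E∈𝒥 with almost-C n
    ... | m , small = positive (m ⊔ n) (ideal-⊆-∪ ideal (E n) (D m ∩ˢ ∁ˢ (C n)) (λ {x} → split x) E∈𝒥 small)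
      where
      split : ∀ x → T (D (m ⊔ n) x) → T ((E n ∪ˢ (D m ∩ˢ ∁ˢ (C n))) x)
      split x d = ∪-intro (E n) (D m ∩ˢ ∁ˢ (C n)) (case T-dichotomy (C n x) of λ where
        (inj₁ c)  → inj₁ (∩-intro (D n) (C n) (antitone (m≤n⊔m m n) d) c)
        (inj₂ ¬c) → inj₂ (∩-intro (D m) (∁ˢ (C n)) (antitone (m≤m⊔n m n) d) ¬c))

    E-decreasing : ∀ n → E (suc n) ⊆ˢ E n
    E-decreasing n p with ∩-elim (D (suc n)) (C (suc n)) p
    ... | d , c = ∩-intro (D n) (C n) (decreasing n d) (proj₁ (∩-elim (C n) (row A n) c))

    pseudo = positive-pseudo-intersection ideal Fσ E E-decreasing E∉𝒥
    X = proj₁ pseudo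

    X⊆*row : ∀ n → X ⊆* row A n
    X⊆*row n with proj₂ (proj₂ pseudo) (suc n)
    ... | N , X⊆E = N , λ x N≤x x∈X →
      proj₂ (∩-elim (C n) (row A n) (proj₂ (∩-elim (D (suc n)) (C (suc n)) (X⊆E x N≤x x∈X))))

    D∩X∉𝒥 : ∀ n → ¬ 𝒥 (D n ∩ˢ X)
    D∩X∉𝒥 n small with proj₂ (proj₂ pseudo) n
    ... | N , X⊆E = proj₁ (proj₂ pseudo) (ideal-⊆* ideal (D n ∩ˢ X) (N , λ x N≤x x∈X →
      ∩-intro (D n) X (proj₁ (∩-elim (D n) (C n) (X⊆E x N≤x x∈X))) x∈X) small)

  SplitsOrPseudo-resp : ∀ {A A′ X} → A ≗ A′ → SplitsOrPseudo A X → SplitsOrPseudo A′ X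
  SplitsOrPseudo-resp A≗A′ = ⊎-map
    (λ (n , X⊆) → n , λ {x} x∈X → T-resp (cong not (A≗A′ (pair (n , x)))) (X⊆ x∈X))
    (λ X⊆* n → let N , X⊆ = X⊆* n in N , λ x N≤x x∈X → T-resp (A≗A′ (pair (n , x))) (X⊆ x N≤x x∈X))

  SplitsOrPseudo-down : ∀ {A X Y} → X ⊆ˢ Y → SplitsOrPseudo A Y → SplitsOrPseudo A X
  SplitsOrPseudo-down X⊆Y = ⊎-map
    (λ (n , Y⊆) → n , λ x∈X → Y⊆ (X⊆Y x∈X))
    (λ Y⊆* n → let N , Y⊆ = Y⊆* n in N , λ x N≤x x∈X → Y⊆ x N≤x (X⊆Y x∈X))

  -- The complements of the given dual sets all belong to 𝒰 (the full set fills the gaps in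
  -- the enumeration), so the requirement of the real joining them can only be met by a
  -- pseudo-intersection.
  meets⇒p-point : ∀ {𝒰} → IsUltrafilter 𝒰 → (∀ A → ∃ λ X → 𝒰 X × SplitsOrPseudo A X) → IsPPoint 𝒰
  meets⇒p-point {𝒰} uf meets 𝒜 (e , enumerates) 𝒜⊆𝒰* = X , X∈𝒰 , fin
    where
    open IsUltrafilter uf

    A-spec : ∀ n → ∃ λ A → 𝒰 A × ((𝒰 *) (e n) → A ⊆ˢ ∁ˢ (e n))
    A-spec n with em₀ {(𝒰 *) (e n)}
    ... | yes small = ∁ˢ (e n) , dual⇒∁ uf small , λ _ → id
    ... | no ¬small = fullˢ , cofinite fullˢ ([] , λ _ ()) , λ small → contradiction small ¬small

    A : ℕ → Subset ℕ
    A n = proj₁ (A-spec n)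

    joined : Subset ℕ
    joined x = uncurry A (unpair x)

    row≗A : ∀ n → row joined n ≗ A n
    row≗A n k = cong (uncurry A) (unpair-pair (n , k))

    X   = proj₁ (meets joined)
    X∈𝒰 = proj₁ (proj₂ (meets joined))

    X⊆*A : ∀ n → X ⊆* A n
    X⊆*A n with proj₂ (proj₂ (meets joined))
    ... | inj₂ X⊆* = let N , X⊆ = X⊆* n in N , λ x N≤x x∈X → T-resp (row≗A n x) (X⊆ x N≤x x∈X)
    ... | inj₁ (k , X⊆∁) = ⊥-elim (proper (⊇-closed (X ∩ˢ A k) ∅ˢ (λ {x} → empty x)
            (∩-closed X (A k) X∈𝒰 (proj₁ (proj₂ (A-spec k))))))
      where
      empty : ∀ x → T ((X ∩ˢ A k) x) → ⊥
      empty x p = let x∈X , a = ∩-elim X (A k) p in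
        T-contradiction (A k x) a (T-resp (cong not (row≗A k x)) (X⊆∁ x∈X))

    fin : ∀ S → 𝒜 S → Finite (S ∩ˢ X)
    fin S S∈𝒜 with enumerates S S∈𝒜
    ... | n , e≗S with X⊆*A n
    ...   | N , X⊆A = bounded⇒finite (S ∩ˢ X) (N , λ x p → ≰⇒> λ N≤x →
      let s , x∈X = ∩-elim S X p in
      T-contradiction (e n x) (T-resp (sym (e≗S x)) s) (proj₂ (proj₂ (A-spec n)) e∈𝒰* (X⊆A x N≤x x∈X)))
      where
      e∈𝒰* : (𝒰 *) (e n)
      e∈𝒰* = IsIdeal.⊆-closed (dual-ideal uf) (e n) S (≗⇒⊆ e≗S) (𝒜⊆𝒰* S∈𝒜)

  p-point-disjoint-from-Fσ : ContinuumHypothesis → ∀ {𝒥} → IsIdeal 𝒥 → IsFσ 𝒥 →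
    ∃ λ 𝒰 → IsUltrafilter 𝒰 × IsPPoint 𝒰 × ∀ A → 𝒥 A → ¬ 𝒰 A
  p-point-disjoint-from-Fσ ch ideal Fσ =
    let 𝒰 , uf , disjoint , meets = meeting-ultrafilter ch ideal SplitsOrPseudo
          (λ {A} {A′} {X} → SplitsOrPseudo-resp {A} {A′} {X}) (λ {A} {X} {Y} → SplitsOrPseudo-down {A} {X} {Y}) (meet-SplitsOrPseudo ideal Fσ)
    in 𝒰 , uf , meets⇒p-point uf meets , disjoint

  coinciding⇒¬extends : ContinuumHypothesis → ∀ {ℐ} → PPointsCoincideWith ℐ → ¬ ExtendsToFσIdeal ℐ
  coinciding⇒¬extends ch {ℐ} coincide (𝒥 , ideal , Fσ , ℐ⊆𝒥) with p-point-disjoint-from-Fσ ch ideal Fσ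
  ... | 𝒰 , uf , p-point , disjoint =
    proj₁ (coincide 𝒰 uf) p-point (id , λ B B∈ℐ → ∉⇒dual uf (disjoint B (ℐ⊆𝒥 B∈ℐ)))

  -- Ultrafilters disjoint from a copy of Fin²

  infinite⇒unbounded : ∀ {A} → ¬ Finite A → ∀ K → ∃ λ k → K ≤ k × T (A k)
  infinite⇒unbounded {A} ¬fin K = by-contradiction λ none → ¬fin
    (bounded⇒finite A (K , λ x x∈A → ≰⇒> λ K≤x → none (x , K≤x , x∈A)))

  positive-columns : ∀ {S} → ¬ Fin² S → ∀ N → ∃ λ n → N ≤ n × ¬ Finite (λ k → S (n , k))
  positive-columns {S} S∉ N = by-contradiction λ none → S∉ (upTo N , λ n n∉ →
    by-contradiction λ ¬fin → none (n , ≮⇒≥ (n∉ ∘ ∈-upTo⁺) , ¬fin))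

  Fin²-ideal : IsIdeal Fin²
  Fin²-ideal = record
    { ∪-closed = λ A B (ms , A-cols) (ns , B-cols) → ms ++ ns , λ n n∉ →
        let as , A⊆ = A-cols n (n∉ ∘ ∈-++⁺ˡ)
            bs , B⊆ = B-cols n (n∉ ∘ ∈-++⁺ʳ ms)
        in as ++ bs , λ k p → case ∪-elim A B p of λ where
          (inj₁ a) → ∈-++⁺ˡ (A⊆ k a)
          (inj₂ b) → ∈-++⁺ʳ as (B⊆ k b)
    ; ⊆-closed = λ A B A⊆B (ns , cols) → ns , λ n n∉ → finite-⊆ A⊆B (cols n n∉)
    ; finite   = λ A (xs , A⊆) → [] , λ n _ → map proj₂ xs , λ k p → ∈-map⁺ proj₂ (A⊆ (n , k) p)
    ; proper   = λ (ns , cols) →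
        let N , ns<N = list-bound ns
            K , all<K = finite⇒bounded fullˢ (cols N λ N∈ → <-irrefl refl (ns<N N N∈))
        in <-irrefl refl (all<K K tt)
    }

  ω-Fin² : Family ℕ
  ω-Fin² S = Fin² (S ∘ pair)

  ω-Fin²-ideal : IsIdeal ω-Fin²
  ω-Fin²-ideal = record
    { ∪-closed = λ A B → ∪-closed (A ∘ pair) (B ∘ pair)
    ; ⊆-closed = λ A B A⊆B → ⊆-closed (A ∘ pair) (B ∘ pair) A⊆B
    ; finite   = λ A (xs , A⊆) → finite (A ∘ pair) (map unpair xs , λ p p∈ →
        subst (List._∈ map unpair xs) (unpair-pair p) (∈-map⁺ unpair (A⊆ (pair p) p∈)))
    ; proper   = proper
    }
    where open IsIdeal Fin²-ideal

  graph : (ℕ → ℕ) → Subset ℕ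
  graph f x = let n , k = unpair x in isYes (f n ≟ k)

  graph-injective : ∀ {f g} → graph f ≗ graph g → f ≗ g
  graph-injective {f} {g} eq n = sym (on-graph g (T-resp (eq (pair (n , f n))) (on-graph′ f refl)))
    where
    at : ∀ h → graph h (pair (n , f n)) ≡ isYes (h n ≟ f n)
    at h = cong (λ p → isYes (h (proj₁ p) ≟ proj₂ p)) (unpair-pair (n , f n))
    on-graph : ∀ h → T (graph h (pair (n , f n))) → h n ≡ f n
    on-graph h t = toWitness (T-resp (at h) t)
    on-graph′ : ∀ h → h n ≡ f n → T (graph h (pair (n , f n)))
    on-graph′ h e = T-resp (sym (at h)) (fromWitness e)

  PreimageFrom : Family ℕ → Subset ℕ → Family ℕ
  PreimageFrom ℐ A X = ∀ f → A ≗ graph f → ∃ λ B → ℐ B × X ⊆ˢ (B ∘ f)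

  -- Choose columns c n ≥ n in which D n is infinite and map the nth column into D n
  -- within column c n, in a finite-to-one way.  Preimages of sets that are small below
  -- some D m are then in Fin².  So if every preimage under f of a member of ℐ were small
  -- below some D m, following the map by f would give ℐ ≤K Fin².
  meet-PreimageFrom : ∀ {ℐ} → ¬ (ℐ ≤K Fin²) → ∀ A (D : ℕ → Subset ℕ) →
    (∀ n → D (suc n) ⊆ˢ D n) → (∀ n → ¬ ω-Fin² (D n)) →
    ∃ λ X → PreimageFrom ℐ A X × ∀ n → ¬ ω-Fin² (D n ∩ˢ X)
  meet-PreimageFrom {ℐ} ¬≤K A D decreasing positive with em₀ {∃ λ f → A ≗ graph f}
  ... | no none = fullˢ , (λ f A≗ → contradiction (f , A≗) none) , λ n small →
    positive n (IsIdeal.⊆-closed ω-Fin²-ideal (D n) (D n ∩ˢ fullˢ) (λ {x} d → ∩-intro (D n) fullˢ {x} d tt) small)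
  ... | yes (f , A≗f) = B ∘ f , (λ g A≗g → B , proj₁ (proj₂ large) , λ {x} →
          T-resp (cong B (graph-injective (λ y → trans (sym (A≗f y)) (A≗g y)) x))) , proj₂ (proj₂ large)
    where
    -- n ≤ c n makes c finite-to-one, which serves as well as injectivity.
    c : ∀ n → ∃ λ i → n ≤ i × ¬ Finite (λ k → D n (pair (i , k)))
    c n = positive-columns (positive n) n

    h : ∀ n k → ∃ λ l → k ≤ l × T (D n (pair (proj₁ (c n) , l)))
    h n k = infinite⇒unbounded (proj₂ (proj₂ (c n))) k

    g : ℕ × ℕ → ℕ
    g (n , k) = f (pair (proj₁ (c n) , proj₁ (h n k)))

    antitone : ∀ {k n} → k ≤ n → D n ⊆ˢ D k
    antitone = decreasing⇒antitone D decreasing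

    pull : ∀ B m → ω-Fin² (D m ∩ˢ (B ∘ f)) → Fin² (B ∘ g)
    pull B m (ns , cols) = upTo (m ⊔ M) , λ n n∉ →
      let m⊔M≤n = ≮⇒≥ (n∉ ∘ ∈-upTo⁺)
          i , n≤i , _ = c n
          i∉ns : ¬ (i List.∈ ns)
          i∉ns i∈ = <-irrefl refl (≤-trans (proj₂ (list-bound ns) i i∈) (≤-trans (m≤n⊔m m M) (≤-trans m⊔M≤n n≤i)))
      in finite-⊆ (λ {k} b → ∩-intro (D m) (B ∘ f) (antitone (≤-trans (m≤m⊔n m M) m⊔M≤n) (proj₂ (proj₂ (h n k)))) b)
           (finite-preimage (λ k → proj₁ (h n k)) (λ k → proj₁ (proj₂ (h n k))) _ (cols i i∉ns))
      where
      M = proj₁ (list-bound ns)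

    large : ∃ λ B → ℐ B × ∀ n → ¬ ω-Fin² (D n ∩ˢ (B ∘ f))
    large = by-contradiction λ none → ¬≤K (g , λ B B∈ℐ →
      let m , ¬¬small = ¬∀⇒∃¬ (λ pos → none (B , B∈ℐ , pos)) in pull B m (by-contradiction ¬¬small))

    B : Subset ℕ
    B = proj₁ large

  meets⇒ultrafilter-for : ∀ {ℐ 𝒰} → IsUltrafilter 𝒰 →
    (∀ A → ∃ λ X → 𝒰 X × PreimageFrom ℐ A X) → IsUltrafilterFor ℐ 𝒰
  meets⇒ultrafilter-for uf meets (f , f-small) with meets (graph f)
  ... | X , X∈𝒰 , pre with pre f (λ _ → refl)
  ...   | B , B∈ℐ , X⊆ = dual-disjoint uf (f-small B B∈ℐ) (IsUltrafilter.⊇-closed uf X (B ∘ f) X⊆ X∈𝒰)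

  column : ℕ → Subset ℕ
  column n x = isYes (proj₁ (unpair x) ≟ n)

  column-small : ∀ n → ω-Fin² (column n)
  column-small n = n ∷ [] , λ m m∉ → [] , λ k p → ⊥-elim (m∉ (here
    (trans (sym (cong proj₁ (unpair-pair (m , k)))) (toWitness p))))

  -- A set almost disjoint from all columns has only finite columns, so it is in ω-Fin².
  disjoint-from-Fin²⇒¬p-point : ∀ {𝒰} → IsUltrafilter 𝒰 → (∀ A → ω-Fin² A → ¬ 𝒰 A) → ¬ IsPPoint 𝒰
  disjoint-from-Fin²⇒¬p-point {𝒰} uf positive p-point with p-point (λ A → ∃ λ n → A ≗ column n) (column , λ A (n , A≗) → n , λ x → sym (A≗ x))
    (λ {A} (n , A≗) → ∉⇒dual uf λ A∈𝒰 →
      positive (column n) (column-small n) (IsUltrafilter.⊇-closed uf A (column n) (≗⇒⊆ A≗) A∈𝒰))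
  ... | B , B∈𝒰 , fin = positive B ([] , λ n _ → column-finite n) B∈𝒰
    where
    column-finite : ∀ n → Finite (λ k → B (pair (n , k)))
    column-finite n with fin (column n) (n , λ _ → refl)
    ... | xs , ⊆xs = map (proj₂ ∘ unpair) xs , λ k b → subst (List._∈ map (proj₂ ∘ unpair) xs) (cong proj₂ (unpair-pair (n , k)))
      (∈-map⁺ (proj₂ ∘ unpair) (⊆xs (pair (n , k))
        (∩-intro (column n) B (fromWitness (cong proj₁ (unpair-pair (n , k)))) b)))

  ultrafilter-for-not-p-point : ContinuumHypothesis → ∀ {ℐ} → ¬ (ℐ ≤K Fin²) →
    ∃ λ 𝒰 → IsUltrafilter 𝒰 × IsUltrafilterFor ℐ 𝒰 × ¬ IsPPoint 𝒰
  ultrafilter-for-not-p-point ch {ℐ} ¬≤K =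
    let 𝒰 , uf , positive , meets = meeting-ultrafilter ch ω-Fin²-ideal (PreimageFrom ℐ)
          (λ A≗A′ pre f A′≗f → pre f λ x → trans (A≗A′ x) (A′≗f x))
          (λ X⊆Y pre f A≗f → let B , B∈ℐ , Y⊆ = pre f A≗f in B , B∈ℐ , λ x∈X → Y⊆ (X⊆Y x∈X))
          (meet-PreimageFrom ¬≤K)
    in 𝒰 , uf , meets⇒ultrafilter-for uf meets , disjoint-from-Fin²⇒¬p-point uf positive

  coinciding⇒≤KFin² : ContinuumHypothesis → ∀ {ℐ} → PPointsCoincideWith ℐ → ℐ ≤K Fin²
  coinciding⇒≤KFin² ch coincide = by-contradiction λ ¬≤K →
    let 𝒰 , uf , for-ℐ , ¬p-point = ultrafilter-for-not-p-point ch ¬≤K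
    in ¬p-point (proj₂ (coincide 𝒰 uf) for-ℐ)

theorem7p4 : ExcludedMiddle (lsuc 0ℓ) →
    (ℐ : Family ℕ) → IsIdeal ℐ → Borel ℐ →
    ((ℐ ≤K Fin² × ¬ ExtendsToFσIdeal ℐ) → PPointsCoincideWith ℐ) ×
    (ContinuumHypothesis → PPointsCoincideWith ℐ → (ℐ ≤K Fin² × ¬ ExtendsToFσIdeal ℐ))
theorem7p4 em ℐ ideal borel =
  (λ (≤Fin² , ¬ext) 𝒰 uf → p-point⇒ultrafilter-for ideal borel ¬ext uf , ultrafilter-for⇒p-point ≤Fin² uf) ,
  (λ ch coincide → coinciding⇒≤KFin² ch coincide , coinciding⇒¬extends ch coincide)
  where open Classical em
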